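{- Let $I=(i_1,\dots,i_k)$ and $J=(j_1,\dots,j_l)$ be compositions of $n$. Then the coefficient $C_I^J(q)$ of $\Psi_I$ in $S^J(q)$ is given by the following rule: (i) if $i_1<j_1$, then $C_I^J(q)=C_{(i_1+i_2,i_3,\dots,i_k)}^J(q)$; (ii) otherwise, \[ C_I^J(q) = \left[\begin{matrix} k+j_1-1\\ j_1\end{matrix}\right]_q C_{I'}^{(j_2,\dots,j_l)}(q), \] where the (ribbon) diagram of $I'$ is obtained by removing the first $j_1$ cells of the diagram of $I$.
   Context: $\mathbf{Sym}$ is the algebra of noncommutative symmetric functions, with complete functions $S_n$ and Tevlin's noncommutative monomial basis $\Psi_I$. $\mathbf{WQSym}$ has basis $\mathbf{M}_u$ indexed by packed words $u$. For a packed word $u$, a special inversion is a pair $i<j$ with $u_i>u_j$ such that $u_j$ is the rightmost occurrence of its letter in $u$; $\mathrm{sinv}(u)$ is their number. The $q$-product $\star_q$ on $\mathbf{WQSym}$ is defined by requiring that the elements $\mathbf{M}'_u=q^{\mathrm{sinv}(u)}\mathbf{M}_u$ multiply (under $\star_q$) exactly as the $\mathbf{M}_u$ multiply under the usual product. The W-composition $\mathrm{WC}(u)$ of a packed word $u$ is the composition whose descent set is the set of positions of the last occurrences of each letter in $u$; the map $\zeta:\mathbf{M}_u\mapsto\Psi_{\mathrm{WC}(u)}$ is an algebra morphism from $\mathbf{WQSym}$ onto $\mathbf{Sym}$. Let $\alpha(S_n)=\sum_u \mathbf{M}_u$ over nondecreasing packed words $u$ of length $n$. For a composition $J=(j_1,\dots,j_r)$,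 $S^J(q)=\zeta(\alpha(S_{j_1})\star_q\cdots\star_q\alpha(S_{j_r}))$, and $C_I^J(q)$ denotes the coefficient of $\Psi_I$ in $S^J(q)$. $\left[\begin{matrix} a\\ b\end{matrix}\right]_q$ denotes the Gaussian $q$-binomial coefficient. -}

module Defs where

open import Algebra.Bundles using (CommutativeRing; Semiring)
import Algebra.Definitions.RawSemiring as RawSemiringOps
import Algebra.Solver.Ring.NaturalCoefficients.Default as RingSolver
open import Data.Fin using (Fin; toℕ)
import Data.Fin as Fin
import Data.Fin.Properties as Fin
open import Data.List using (List; []; _∷_; _++_; [_]; length; map; concatMap; foldr; filter; deduplicate; take; drop; upTo; allFin; lookup; zipWith; cartesianProduct; cartesianProductWith; mapMaybe)
open import Data.List.Membership.DecPropositional using (_∈?_)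
open import Data.List.Membership.Propositional using (_∈_)
open import Data.List.Properties using (≡-dec)
open import Data.List.Relation.Unary.All using (All; all?)
open import Data.List.Relation.Unary.Linked using (Linked; linked?)
import Data.Maybe as Maybe
open import Data.Nat using (ℕ; zero; suc; pred; _+_; _∸_; _≤_; _<_; NonZero; _≟_; _≤?_; _<?_; s≤s⁻¹)
open import Data.Nat.ListAction using (sum)
open import Data.Nat.Properties using (+-identityʳ; +-suc; n<1+n; m<n⇒m<1+n)
open import Data.Product using (_×_; _,_)
open import Data.Sum using (_⊎_)
open import Function using (_∘_)
open import Level using (_⊔_) renaming (suc to lsuc)
open import Relation.Binary.Definitions using (DecidableEquality)
open import Relation.Binary.PropositionalEquality using (_≡_; _≢_)
open import Relation.Nullary using (yes; no; ¬?; _×-dec_; _⊎-dec_; _→-dec_)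
open import Relation.Nullary.Decidable using (dec⇒maybe)
open import Relation.Unary using (Decidable)

infix 4 _⊨_

_⊨_ : List ℕ → ℕ → Set
I ⊨ n = All (0 <_) I × sum I ≡ n

compositions : ℕ → List (List ℕ)
compositions zero    = [ [] ]
compositions (suc n) = concatMap extend (compositions n)
  where
  extend : List ℕ → List (List ℕ)
  extend []      = [ [ 1 ] ]
  extend (i ∷ I) = (1 ∷ i ∷ I) ∷ (suc i ∷ I) ∷ []

-- (i₁, i₂, i₃, …) ↦ (i₁ + i₂, i₃, …); the other clauses are never reached
-- when i₁ < n.
mergeFirstTwo : List ℕ → List ℕ
mergeFirstTwo (i₁ ∷ i₂ ∷ I) = i₁ + i₂ ∷ I
mergeFirstTwo I             = I

-- The rows of the ribbon diagram of (i₁, …, iₖ) have i₁, …, iₖ cells, and the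
-- cells are read row by row.
removeCells : ℕ → List ℕ → List ℕ
removeCells m [] = []
removeCells m (i ∷ I) with m <? i
... | yes _ = i ∸ m ∷ I
... | no  _ = removeCells (m ∸ i) I

Word : Set
Word = List ℕ

Packed : Word → Set
Packed u = All (λ x → 0 < x × (x ≡ 1 ⊎ pred x ∈ u)) u

packed? : Decidable Packed
packed? u = all? (λ x → (0 <? x) ×-dec ((x ≟ 1) ⊎-dec (_∈?_ _≟_ (pred x) u))) u

record PackedWord : Set where
  constructor ⟨_,_⟩
  field
    letters : Word
    .packed : Packed letters

open PackedWord public

ε : PackedWord
ε = ⟨ [] , All.[] ⟩

-- Replaces the i-th smallest letter occurring in w by i.
pack : Word → Word
pack w = map (λ x → length (filter (_≤? x) (deduplicate _≟_ w))) w

words : (alphabet length : ℕ) → List Word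
words m zero    = [ [] ]
words m (suc n) = cartesianProductWith _∷_ (map suc (upTo m)) (words m n)

-- The letters of a packed word of length n are at most n.
packedWords : ℕ → List PackedWord
packedWords n = mapMaybe (λ w → Maybe.map (λ p → ⟨ w , p ⟩) (dec⇒maybe (packed? w))) (words n n)

nondecreasingPackedWords : ℕ → List PackedWord
nondecreasingPackedWords n = filter (λ u → linked? _≤?_ (letters u)) (packedWords n)

-- The packed words w = u′v′ with pack u′ = u and pack v′ = v.
convolution : PackedWord → PackedWord → List PackedWord
convolution u v = filter convolved? (packedWords (a + length (letters v)))
  where
  a = length (letters u)

  Convolved : PackedWord → Set
  Convolved w = pack (take a (letters w)) ≡ letters u × pack (drop a (letters w)) ≡ letters v

  convolved? : Decidable Convolved
  convolved? w = ≡-dec _≟_ _ _ ×-dec ≡-dec _≟_ _ _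

IsLastOccurrence : (u : Word) → Fin (length u) → Set
IsLastOccurrence u j = ∀ k → j Fin.< k → lookup u k ≢ lookup u j

isLastOccurrence? : ∀ u → Decidable (IsLastOccurrence u)
isLastOccurrence? u j = Fin.all? λ k → (j Fin.<? k) →-dec ¬? (lookup u k ≟ lookup u j)

SpecialInversion : (u : Word) → Fin (length u) × Fin (length u) → Set
SpecialInversion u (i , j) = i Fin.< j × lookup u j < lookup u i × IsLastOccurrence u j

specialInversion? : ∀ u → Decidable (SpecialInversion u)
specialInversion? u (i , j) = (i Fin.<? j) ×-dec (lookup u j <? lookup u i) ×-dec isLastOccurrence? u j

sinv : Word → ℕ
sinv u = length (filter (specialInversion? u) (cartesianProduct (allFin (length u)) (allFin (length u))))

-- Positions are counted from 1 and listed increasingly.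
lastPositions : Word → List ℕ
lastPositions u = map (suc ∘ toℕ) (filter (isLastOccurrence? u) (allFin (length u)))

differences : ℕ → List ℕ → List ℕ
differences p []       = []
differences p (d ∷ ds) = d ∸ p ∷ differences d ds

-- The last position |u| always ends a part, so the descents proper are the last
-- positions other than |u|.
WC : Word → List ℕ
WC u = differences 0 (lastPositions u)

-- A commutative ℚ-algebra with an invertible element q,
-- for instance ℚ(q) or ℚ[q , q⁻¹].
record GroundRing c ℓ : Set (lsuc (c ⊔ ℓ)) where
  field
    commutativeRing : CommutativeRing c ℓ
  open CommutativeRing commutativeRing public renaming (_+_ to _+ᴷ_)
  open RawSemiringOps (Semiring.rawSemiring semiring) public using (_^_) renaming (_×_ to _·_)
  field
    1/_     : (n : ℕ) .{{_ : NonZero n}} → Carrier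
    1/-inv  : (n : ℕ) .{{_ : NonZero n}} → (n · 1#) * (1/ n) ≈ 1#
    q q⁻¹   : Carrier
    q*q⁻¹≈1 : q * q⁻¹ ≈ 1#

module NoncommutativeSymmetricFunctions {c ℓ} (K : GroundRing c ℓ) where

  open GroundRing K using (Carrier; 0#; 1#; _*_; _+ᴷ_; _^_; _·_; 1/_; q; q⁻¹) renaming (-_ to -ᴷ_; _≈_ to _≈ᴷ_) public

  -- The Gaussian binomial coefficient, as a polynomial in q, via the q-Pascal
  -- rule; gauss-factorials is the quotient formula.
  gauss : ℕ → ℕ → Carrier
  gauss n       zero    = 1#
  gauss zero    (suc k) = 0#
  gauss (suc n) (suc k) = gauss n k +ᴷ q ^ suc k * gauss n (suc k)

  q-integer q-factorial : ℕ → Carrier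
  q-integer zero      = 0#
  q-integer (suc n)   = 1# +ᴷ q * q-integer n
  q-factorial zero    = 1#
  q-factorial (suc n) = q-integer (suc n) * q-factorial n

  private
    module R = GroundRing K
    open RingSolver R.commutativeSemiring using (solve; _:=_; _:+_; _:*_)

    gauss-vanishes : ∀ {n k} → n < k → gauss n k ≈ᴷ 0#
    gauss-vanishes {zero}  {suc k} _   = R.refl
    gauss-vanishes {suc n} {suc k} n<k =
      R.trans (R.+-cong (gauss-vanishes (s≤s⁻¹ n<k)) (R.trans (R.*-congˡ (gauss-vanishes (m<n⇒m<1+n (s≤s⁻¹ n<k)))) (R.zeroʳ _))) (R.+-identityˡ 0#)

    q-integer-+ : ∀ m n → q-integer m +ᴷ q ^ m * q-integer n ≈ᴷ q-integer (m + n)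
    q-integer-+ zero    n = R.trans (R.+-identityˡ _) (R.*-identityˡ _)
    q-integer-+ (suc m) n = R.trans
      (solve 5 (λ o x a b d → (o :+ x :* a) :+ (x :* b) :* d := o :+ x :* (a :+ b :* d)) R.refl 1# q (q-integer m) (q ^ m) (q-integer n))
      (R.+-congˡ (R.*-congˡ (q-integer-+ m n)))

  gauss-factorials : ∀ m n → gauss (m + n) m * (q-factorial m * q-factorial n) ≈ᴷ q-factorial (m + n)
  gauss-factorials zero    n = R.trans (R.*-identityˡ _) (R.*-identityˡ _)
  gauss-factorials (suc m) zero rewrite +-identityʳ m = R.trans
    (R.*-cong (R.trans (R.+-cong (gauss-diagonal m) (R.trans (R.*-congˡ (gauss-vanishes (n<1+n m))) (R.zeroʳ _))) (R.+-identityʳ 1#)) (R.*-identityʳ _))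
    (R.*-identityˡ _)
    where
    gauss-diagonal : ∀ m → gauss m m ≈ᴷ 1#
    gauss-diagonal zero    = R.refl
    gauss-diagonal (suc m) = R.trans
      (R.+-cong (gauss-diagonal m) (R.trans (R.*-congˡ (gauss-vanishes (n<1+n m))) (R.zeroʳ _)))
      (R.+-identityʳ 1#)
  gauss-factorials (suc m) (suc n) = R.trans
    (solve 7 (λ A B Q a b f g → (A :+ Q :* B) :* ((a :* f) :* (b :* g)) := a :* (A :* (f :* (b :* g))) :+ Q :* b :* (B :* ((a :* f) :* g))) R.refl
      (gauss (m + suc n) m) (gauss (m + suc n) (suc m)) (q ^ suc m) (q-integer (suc m)) (q-integer (suc n)) (q-factorial m) (q-factorial n))
    (R.trans (R.+-cong (R.*-congˡ (gauss-factorials m (suc n))) (R.*-congˡ shifted))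
    (R.trans (R.sym (R.distribʳ _ _ _)) (R.*-congʳ (q-integer-+ (suc m) (suc n)))))
    where
    shifted : gauss (m + suc n) (suc m) * (q-factorial (suc m) * q-factorial n) ≈ᴷ q-factorial (m + suc n)
    shifted rewrite +-suc m n = gauss-factorials (suc m) n

  -- Formal K-linear combinations of elements of X; repeated entries add up.
  Lin : Set → Set c
  Lin X = List (Carrier × X)

  module _ {X : Set} where

    basis : X → Lin X
    basis x = [ 1# , x ]

    infixl 6 _⊕_ _⊖_
    infixr 7 _•_

    _⊕_ : Lin X → Lin X → Lin X
    _⊕_ = _++_

    _•_ : Carrier → Lin X → Lin X
    a • f = map (λ (b , x) → a * b , x) f

    _⊖_ : Lin X → Lin X → Lin X
    f ⊖ g = f ⊕ (-ᴷ 1#) • g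

    ∑ : {Y : Set} → List Y → (Y → Lin X) → Lin X
    ∑ ys f = concatMap f ys

    coefficient : DecidableEquality X → Lin X → X → Carrier
    coefficient _≟ˣ_ []            x = 0#
    coefficient _≟ˣ_ ((a , y) ∷ f) x with y ≟ˣ x
    ... | yes _ = a +ᴷ coefficient _≟ˣ_ f x
    ... | no  _ = coefficient _≟ˣ_ f x

  linearExtension : {X Y : Set} → (X → Lin Y) → Lin X → Lin Y
  linearExtension φ f = concatMap (λ (a , x) → a • φ x) f

  bilinearExtension : {X Y Z : Set} → (X → Y → Lin Z) → Lin X → Lin Y → Lin Z
  bilinearExtension β f g = linearExtension (λ x → linearExtension (β x) g) f

  -- The free associative algebra on S₁, S₂, …; the letter m of a word stands for
  -- the generator S_{m+1}.
  Sym : Set c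
  Sym = Lin (List ℕ)

  infix 4 _≈_

  _≈_ : Sym → Sym → Set ℓ
  f ≈ g = ∀ w → coefficient (≡-dec _≟_) f w ≈ᴷ coefficient (≡-dec _≟_) g w

  infixl 7 _⊛_

  _⊛_ : Sym → Sym → Sym
  _⊛_ = bilinearExtension (λ v w → basis (v ++ w))

  S : ℕ → Sym
  S zero    = basis []
  S (suc m) = basis [ m ]

  -- The power sums of the first kind Ψₙ, Ψₙ₋₁, …, Ψ₁, where
  -- n Sₙ = Sₙ₋₁ Ψ₁ + Sₙ₋₂ Ψ₂ + ⋯ + S₀ Ψₙ.
  powerSums : ℕ → List Sym
  powerSums zero    = []
  powerSums (suc n) =
    ((suc n · 1#) • S (suc n) ⊖ foldr _⊕_ [] (zipWith _⊛_ (map (S ∘ suc) (upTo n)) (powerSums n)))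
    ∷ powerSums n

  powerSum : ℕ → Sym
  powerSum n with powerSums n
  ... | []    = []
  ... | p ∷ _ = p

  -- Tevlin's monomial functions are given by a quasideterminant: if I = (i₁,…,iᵣ),
  --
  --                         | Ψ_{iᵣ}              1                      0   |
  --                         | Ψ_{iᵣ₋₁+iᵣ}         Ψ_{iᵣ₋₁}     2             |
  --   r Ψ_I = (-1)^{r-1}    |   ⋮                             ⋱              |
  --                         | Ψ_{i₂+⋯+iᵣ}           ⋯        Ψ_{i₂}     r-1  |
  --                         | [Ψ_{i₁+⋯+iᵣ}]         ⋯                 Ψ_{i₁} |
  --
  -- Since the minor of the boxed entry is triangular, this expands to
  --
  --   r Ψ_I = ∑_{1 ≤ s ≤ r} (-1)^{s-1} Ψ_{i₁+⋯+iₛ} Ψ_{(iₛ₊₁,…,iᵣ)},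
  --
  -- with Ψ_{()} = 1; here tevlinSum a I starts the sum at Ψ_a Ψ_I.
  mutual
    Ψ : List ℕ → Sym
    Ψ []      = S 0
    Ψ (i ∷ I) = (1/ suc (length I)) • tevlinSum i I

    tevlinSum : ℕ → List ℕ → Sym
    tevlinSum a []      = powerSum a
    tevlinSum a (i ∷ I) = powerSum a ⊛ Ψ (i ∷ I) ⊖ tevlinSum (a + i) I

  WQSym : Set c
  WQSym = Lin PackedWord

  M : PackedWord → WQSym
  M = basis

  infixl 7 _⊙_

  _⊙_ : WQSym → WQSym → WQSym
  _⊙_ = bilinearExtension (λ u v → ∑ (convolution u v) M)

  M′ : PackedWord → WQSym
  M′ u = (q ^ sinv (letters u)) • M u

  -- The linear map M_u ↦ M′_u and its inverse.
  rescale unscale : WQSym → WQSym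
  rescale = linearExtension M′
  unscale = linearExtension (λ u → (q⁻¹ ^ sinv (letters u)) • M u)

  -- The unique bilinear product under which the M′_u multiply as the M_u do
  -- under _⊙_.
  infixr 7 _⋆_

  _⋆_ : WQSym → WQSym → WQSym
  f ⋆ g = rescale (unscale f ⊙ unscale g)

  ζ : WQSym → Sym
  ζ = linearExtension (λ u → Ψ (WC (letters u)))

  αS : ℕ → WQSym
  αS n = ∑ (nondecreasingPackedWords n) M

  -- S^J(q); M_ε is the unit of _⋆_.
  S^_⟨q⟩ : List ℕ → Sym
  S^ J ⟨q⟩ = ζ (foldr (λ j f → αS j ⋆ f) (M ε) J)

  -- C I J is the coefficient of Ψ_I in S^J(q), for all compositions I and J of
  -- the same n. (The Ψ_I for I ⊨ n are linearly independent, so this determines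
  -- C on such pairs; other values of C are irrelevant.)
  IsCoefficientOfΨ : (List ℕ → List ℕ → Carrier) → Set ℓ
  IsCoefficientOfΨ C = ∀ n J → J ⊨ n → S^ J ⟨q⟩ ≈ ∑ (compositions n) (λ I → C I J • Ψ I)

{-# OPTIONS --safe #-}

-- Since sinv vanishes on nondecreasing words, S^J(q) = ∑ q^{sinv w} Ψ_{WC w} over the packed words w that are
-- nondecreasing on consecutive blocks of lengths j₁, j₂, …. A packed word is built from right to left by prepending
-- letters: the new first letter x either occurs already, in which case the first part of WC grows by one, or it is a
-- new value, in which case WC gets a new first part 1. In both cases every value below x occurs further right, so sinv
-- grows by x - 1. The steps are therefore dictated by I, and prepending a block of length j sums
-- q^{(x₁ - 1) + ⋯ + (xⱼ - 1)} over all x₁ ≤ ⋯ ≤ xⱼ ≤ k, where k is the number of parts of I that remain after removing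
-- its first j - 1 cells. This sum is a Gaussian binomial, and
--
--   C_I^{(j, J)} = [k + j - 1, j]_q C_{I′}^J,   I′ being I without its first j cells,
--
-- from which both rules are read off. The Ψ_I are linearly independent: Ψₙ is n Sₙ plus words beginning with an S of
-- smaller index, so the power sums are free, and the expansion of the Ψ_I in power sums can be inverted.
module Submission where

open import Defs
import Algebra.Solver.Ring.NaturalCoefficients.Default as RingSolver
open import Data.Bool using (true; false)
open import Data.Fin using (Fin; toℕ)
import Data.Fin as Fin
open import Data.List using (List; []; _∷_; _++_; [_]; length; map; concatMap; filter; deduplicate; take; drop; upTo; allFin; lookup; foldr; zipWith; cartesianProduct; mapMaybe)
open import Data.List.Membership.DecPropositional using (_∈?_)
open import Data.List.Membership.Propositional using (_∈_; _∉_; find; lose)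
open import Data.List.Membership.Propositional.Properties using (∈-map⁺; ∈-map⁻; ∈-++⁺ˡ; ∈-++⁺ʳ; ∈-++⁻; ∈-concatMap⁺; ∈-concatMap⁻; ∈-cartesianProductWith⁺; ∈-cartesianProductWith⁻; ∈-upTo⁺; ∈-upTo⁻; ∈-filter⁺; ∈-filter⁻; ∈-deduplicate⁺; ∈-deduplicate⁻; ∈-lookup)
open import Data.List.Membership.Propositional.Properties.WithK using (unique∧set⇒bag)
open import Data.List.Properties using (≡-dec; ∷-injective; ∷-injectiveˡ; ∷-injectiveʳ; ++-identityʳ; map-∘; map-cong; map-id; map-cong-local; map-tabulate; length-map; length-++; length-upTo; length-take; filter-≐; filter-++; filter-accept; filter-reject; filter-none; drop-map; take-map; upTo-∷ʳ)
open import Data.List.Relation.Binary.BagAndSetEquality using (∼bag⇒↭)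
open import Data.List.Relation.Binary.Permutation.Propositional as ↭ using (_↭_)
open import Data.List.Relation.Binary.Permutation.Propositional.Properties using (↭-length)
open import Data.List.Relation.Unary.All as All using (All; []; _∷_)
import Data.List.Relation.Unary.All.Properties as All
open import Data.List.Relation.Unary.AllPairs using (AllPairs; []; _∷_)
open import Data.List.Relation.Unary.Any using (here; there; index)
open import Data.List.Relation.Unary.Any.Properties using (lookup-index)
open import Data.List.Relation.Unary.Linked as Linked using (Linked; []; [-]; _∷_; linked?)
import Data.List.Relation.Unary.Linked.Properties as Linked
open import Data.List.Relation.Unary.Unique.DecPropositional.Properties using (deduplicate-!)
open import Data.List.Relation.Unary.Unique.Propositional using (Unique)
import Data.List.Relation.Unary.Unique.Propositional.Properties as Unique
import Data.Maybe as Maybe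
open import Data.Nat using (ℕ; zero; suc; pred; _+_; _∸_; _⊔_; _≤_; _<_; z≤n; s≤s; z<s; s<s; s≤s⁻¹; _≟_; _≤?_; _<?_)
open import Data.Nat.ListAction using (sum)
open import Data.Nat.Properties
open import Data.Product using (_×_; _,_; proj₁; proj₂; Σ; ∃)
open import Data.Sum using (_⊎_; inj₁; inj₂; reduce)
open import Function using (_∘_; id; _⇔_; mk⇔; Equivalence)
open import Level using (Level)
open import Relation.Binary.Definitions using (DecidableEquality)
open import Relation.Binary.PropositionalEquality using (_≡_; _≢_; refl; sym; trans; cong; cong₂; subst; module ≡-Reasoning)
import Relation.Binary.Reasoning.Setoid as SetoidReasoning
open import Relation.Nullary using (¬_; Dec; yes; no; does; _because_; contradiction; recompute; _×-dec_)
open import Relation.Nullary.Decidable using (dec⇒maybe)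
open import Relation.Unary using (Decidable)
open Equivalence using (to; from)

-- A single Gaussian binomial results because, inside a block, the exponent `x - 1` and the range of
-- `x` do not depend on whether `x` is an old or a new value: a new `x` pushes the letters from `x`
-- on up by one, but `x` is at most its right neighbour before the push exactly when it is so
-- afterwards. Only the rightmost letter of a block differs. If the word behind it has m values,
-- that letter has m choices when it is old and m + 1 when it is new; in both cases this is the
-- number of parts of I just before the cell of that letter is removed, whence the `j - 1` cells.
-- Rule (i) holds since removing `j₁ - 1` or `j₁` cells consumes the whole first row when `i₁ < j₁`,
-- rule (ii) since removing `j₁ - 1 < i₁` cells leaves all rows in place.
--
-- Formal sums are lists with possible repetitions over a ring that may have zero divisors. They are
-- therefore compared through linear functionals, and only powers of q and positive integers are
-- ever cancelled.

unique∧set⇒↭ : {A : Set} {xs ys : List A} → Unique xs → Unique ys → (∀ {z} → z ∈ xs → z ∈ ys) → (∀ {z} → z ∈ ys → z ∈ xs) → xs ↭ ys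
unique∧set⇒↭ xs! ys! ⊆ ⊇ = ∼bag⇒↭ (unique∧set⇒bag xs! ys! (mk⇔ ⊆ ⊇))

-- The retraction `g` recovers from an element the block that it came from, so distinct blocks are
-- disjoint.
concatMap-unique : {A B : Set} (f : A → List B) (g : B → A) {xs : List A} → Unique xs →
  (∀ {x} → x ∈ xs → Unique (f x)) → (∀ {x} → x ∈ xs → ∀ {y} → y ∈ f x → g y ≡ x) → Unique (concatMap f xs)
concatMap-unique f g {[]} [] f! section = []
concatMap-unique f g {x ∷ xs} (x∉xs ∷ xs!) f! section =
  Unique.++⁺ (f! (here refl)) (concatMap-unique f g xs! (f! ∘ there) (section ∘ there)) disjoint
  where
  disjoint : ∀ {y} → y ∈ f x × y ∈ concatMap f xs → _
  disjoint (y∈fx , y∈rest) with x′ , x′∈xs , y∈fx′ ← find (∈-concatMap⁻ f y∈rest) =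
    All.lookup x∉xs x′∈xs (trans (sym (section (here refl) y∈fx)) (section (there x′∈xs) y∈fx′))

letters≤ : ℕ → Word
letters≤ k = map suc (upTo k)

∈-letters≤⁺ : ∀ {k y} → 0 < y → y ≤ k → y ∈ letters≤ k
∈-letters≤⁺ {y = suc y} _ y≤k = ∈-map⁺ suc (∈-upTo⁺ y≤k)

∈-letters≤⁻ : ∀ {k y} → y ∈ letters≤ k → 0 < y × y ≤ k
∈-letters≤⁻ y∈ with _ , x∈ , refl ← ∈-map⁻ suc y∈ = z<s , ∈-upTo⁻ x∈

letters≤-unique : ∀ k → Unique (letters≤ k)
letters≤-unique k = Unique.map⁺ suc-injective (Unique.upTo⁺ k)

length-letters≤ : ∀ k → length (letters≤ k) ≡ k
length-letters≤ k = trans (length-map suc (upTo k)) (length-upTo k)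

-- Packed words

-- The form of packedness used below. It names the number of values, on which all counts depend.
Range : Word → ℕ → Set
Range w k = ∀ y → y ∈ w ⇔ (0 < y × y ≤ k)

range⇒packed : ∀ {w k} → Range w k → Packed w
range⇒packed {w} r = All.tabulate λ {x} x∈w → proj₁ (to (r x) x∈w) , below x x∈w
  where
  below : ∀ x → x ∈ w → x ≡ 1 ⊎ pred x ∈ w
  below zero          x∈w = contradiction (proj₁ (to (r 0) x∈w)) λ ()
  below (suc zero)    x∈w = inj₁ refl
  below (suc (suc x)) x∈w = inj₂ (from (r (suc x)) (z<s , <⇒≤ (proj₂ (to (r _) x∈w))))

maxLetter : Word → ℕ
maxLetter []      = 0
maxLetter (x ∷ w) = x ⊔ maxLetter w

∈⇒≤maxLetter : ∀ {w x} → x ∈ w → x ≤ maxLetter w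
∈⇒≤maxLetter {x ∷ w} (here refl) = m≤m⊔n x (maxLetter w)
∈⇒≤maxLetter {y ∷ w} (there x∈w) = ≤-trans (∈⇒≤maxLetter x∈w) (m≤n⊔m y (maxLetter w))

maxLetter≡0⊎∈ : ∀ w → maxLetter w ≡ 0 ⊎ maxLetter w ∈ w
maxLetter≡0⊎∈ []      = inj₁ refl
maxLetter≡0⊎∈ (x ∷ w) with ≤-total x (maxLetter w) | maxLetter≡0⊎∈ w
... | inj₂ m≤x | _        = inj₂ (here (m≥n⇒m⊔n≡m m≤x))
... | inj₁ x≤m | inj₁ m≡0 = inj₁ (trans (m≤n⇒m⊔n≡n x≤m) m≡0)
... | inj₁ x≤m | inj₂ m∈w = inj₂ (there (subst (_∈ w) (sym (m≤n⇒m⊔n≡n x≤m)) m∈w))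

-- Packed words are closed under taking predecessors of letters above 1, so descending from the
-- maximal letter meets every smaller positive value.
packed⇒range : ∀ {w} → Packed w → Range w (maxLetter w)
packed⇒range {w} p y = mk⇔ (λ y∈w → proj₁ (All.lookup p y∈w) , ∈⇒≤maxLetter y∈w) (bounded⇒∈ (maxLetter≡0⊎∈ w))
  where
  descend : ∀ x → x ∈ w → 0 < y → y ≤ x → y ∈ w
  descend x x∈w 0<y y≤x with m≤n⇒m<n∨m≡n y≤x
  ... | inj₂ refl = x∈w
  descend (suc x) x∈w 0<y y≤x | inj₁ y<x with proj₂ (All.lookup p x∈w)
  ... | inj₁ refl = contradiction 0<y (<⇒≱ y<x)
  ... | inj₂ x∈w′ = descend x x∈w′ 0<y (s≤s⁻¹ y<x)

  bounded⇒∈ : maxLetter w ≡ 0 ⊎ maxLetter w ∈ w → 0 < y × y ≤ maxLetter w → y ∈ w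
  bounded⇒∈ (inj₂ m∈w) (0<y , y≤m) = descend _ m∈w 0<y y≤m
  bounded⇒∈ (inj₁ m≡0) (0<y , y≤m) = contradiction (≤-trans y≤m (≤-reflexive m≡0)) (<⇒≱ 0<y)

range-unique-length : ∀ {w k} → Unique w → Range w k → length w ≡ k
range-unique-length {w} {k} w! r = trans
  (↭-length (unique∧set⇒↭ w! (letters≤-unique k)
    (λ {y} y∈w → let 0<y , y≤k = to (r y) y∈w in ∈-letters≤⁺ 0<y y≤k)
    (λ {y} y∈ → from (r y) (∈-letters≤⁻ y∈))))
  (length-letters≤ k)

-- Last occurrences

-- One copy of each letter, taken at its last occurrence: these are the possible right ends of
-- special inversions.
lasts : Word → Word
lasts []      = []
lasts (x ∷ w) with _∈?_ _≟_ x w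
... | yes _ = lasts w
... | no  _ = x ∷ lasts w

∈-lasts⁺ : ∀ {w x} → x ∈ w → x ∈ lasts w
∈-lasts⁺ {y ∷ w} x∈ with _∈?_ _≟_ y w
∈-lasts⁺ {y ∷ w} (here refl) | yes y∈w = ∈-lasts⁺ y∈w
∈-lasts⁺ {y ∷ w} (there x∈w) | yes y∈w = ∈-lasts⁺ x∈w
∈-lasts⁺ {y ∷ w} (here refl) | no  y∉w = here refl
∈-lasts⁺ {y ∷ w} (there x∈w) | no  y∉w = there (∈-lasts⁺ x∈w)

∈-lasts⁻ : ∀ {w x} → x ∈ lasts w → x ∈ w
∈-lasts⁻ {y ∷ w} x∈ with _∈?_ _≟_ y w
∈-lasts⁻ {y ∷ w} x∈          | yes y∈w = there (∈-lasts⁻ x∈)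
∈-lasts⁻ {y ∷ w} (here refl) | no  y∉w = here refl
∈-lasts⁻ {y ∷ w} (there x∈)  | no  y∉w = there (∈-lasts⁻ x∈)

lasts-unique : ∀ w → Unique (lasts w)
lasts-unique []      = []
lasts-unique (x ∷ w) with _∈?_ _≟_ x w
... | yes _   = lasts-unique w
... | no  x∉w = All.tabulate (λ { y∈ refl → x∉w (∈-lasts⁻ y∈) }) ∷ lasts-unique w

length-lasts : ∀ w → length (lasts w) ≤ length w
length-lasts []      = z≤n
length-lasts (x ∷ w) with _∈?_ _≟_ x w
... | yes _ = m≤n⇒m≤1+n (length-lasts w)
... | no  _ = s≤s (length-lasts w)

range⇒length-lasts : ∀ {w k} → Range w k → length (lasts w) ≡ k
range⇒length-lasts {w} r = range-unique-length (lasts-unique w) λ y → mk⇔ (to (r y) ∘ ∈-lasts⁻) (∈-lasts⁺ ∘ from (r y))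

-- The source of the exponent `x - 1` in the overview, for the letter `suc x`: all of 1, ..., x
-- occur in `w`, each with one last occurrence.
range⇒length-lasts< : ∀ {w k} → Range w k → ∀ {x} → x ≤ k → length (filter (_<? suc x) (lasts w)) ≡ x
range⇒length-lasts< {w} {k} r {x} x≤k = range-unique-length (Unique.filter⁺ (_<? suc x) (lasts-unique w)) λ y → mk⇔
  (λ y∈ → let y∈w , y<x = ∈-filter⁻ (_<? suc x) {xs = lasts w} y∈ in proj₁ (to (r y) (∈-lasts⁻ y∈w)) , s≤s⁻¹ y<x)
  (λ (0<y , y≤x) → ∈-filter⁺ (_<? suc x) (∈-lasts⁺ (from (r y) (0<y , ≤-trans y≤x x≤k))) (s≤s y≤x))

-- The W-composition, built from right to left

increment : List ℕ → List ℕ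
increment []      = []
increment (i ∷ I) = suc i ∷ I

wc : Word → List ℕ
wc []      = []
wc (x ∷ w) with _∈?_ _≟_ x w
... | yes _ = increment (wc w)
... | no  _ = 1 ∷ wc w

length-wc : ∀ w → length (wc w) ≡ length (lasts w)
length-wc []      = refl
length-wc (x ∷ w) with _∈?_ _≟_ x w
... | no  _ = cong suc (length-wc w)
... | yes _ with wc w | length-wc w
...   | []    | eq = eq
...   | _ ∷ _ | eq = eq

wc-positive : ∀ w → All (0 <_) (wc w)
wc-positive []      = []
wc-positive (x ∷ w) with _∈?_ _≟_ x w
... | no  _ = z<s ∷ wc-positive w
... | yes _ with wc w | wc-positive w
...   | []    | _      = []
...   | _ ∷ _ | _ ∷ ps = z<s ∷ ps

-- Needed for `sum-wc`: `increment` leaves the empty list empty and would lose a cell there, but a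
-- letter that recurs has a nonempty word behind it.
wc≡[]⇒[] : ∀ {w} → wc w ≡ [] → w ≡ []
wc≡[]⇒[] {[]}    _  = refl
wc≡[]⇒[] {x ∷ w} eq with _∈?_ _≟_ x w
... | yes x∈w with wc w | wc≡[]⇒[] {w}
...   | [] | ih with refl ← ih refl with () ← x∈w

sum-wc : ∀ w → sum (wc w) ≡ length w
sum-wc []      = refl
sum-wc (x ∷ w) with _∈?_ _≟_ x w
... | no  _ = cong suc (sum-wc w)
... | yes x∈w with wc w | sum-wc w | wc≡[]⇒[] {w}
...   | _ ∷ _ | eq | _ = cong suc eq
...   | []    | _  | ih with refl ← ih refl with () ← x∈w

-- Special inversions by left end, and agreement with the positional definitions

specialInversions : Word → ℕ
specialInversions []      = 0
specialInversions (x ∷ w) = length (filter (_<? x) (lasts w)) + specialInversions w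

filter-map : {A B : Set} {P : B → Set} (P? : Decidable P) (f : A → B) → ∀ xs → filter P? (map f xs) ≡ map f (filter (P? ∘ f) xs)
filter-map P? f []       = refl
filter-map P? f (x ∷ xs) with does (P? (f x))
... | true  = cong (f x ∷_) (filter-map P? f xs)
... | false = filter-map P? f xs

filter-filter : {A : Set} {P Q : A → Set} (P? : Decidable P) (Q? : Decidable Q) → ∀ xs → filter P? (filter Q? xs) ≡ filter (λ x → P? x ×-dec Q? x) xs
filter-filter P? Q? [] = refl
filter-filter P? Q? (x ∷ xs) with Q? x
... | false because _ with does (P? x)
...   | true  = filter-filter P? Q? xs
...   | false = filter-filter P? Q? xs
filter-filter P? Q? (x ∷ xs) | true because _ with does (P? x)
...   | true  = cong (x ∷_) (filter-filter P? Q? xs)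
...   | false = filter-filter P? Q? xs

allFin-suc : ∀ n → allFin (suc n) ≡ Fin.zero ∷ map Fin.suc (allFin n)
allFin-suc n = cong (Fin.zero ∷_) (sym (map-tabulate id Fin.suc))

lastIndices : (w : Word) → List (Fin (length w))
lastIndices w = filter (isLastOccurrence? w) (allFin (length w))

isLast-suc⁺ : ∀ {x w j} → IsLastOccurrence w j → IsLastOccurrence (x ∷ w) (Fin.suc j)
isLast-suc⁺ last (Fin.suc k) j<k = last k (s≤s⁻¹ j<k)

isLast-suc⁻ : ∀ {x w j} → IsLastOccurrence (x ∷ w) (Fin.suc j) → IsLastOccurrence w j
isLast-suc⁻ last k j<k = last (Fin.suc k) (s<s j<k)

isLast-zero⁺ : ∀ {x w} → x ∉ w → IsLastOccurrence (x ∷ w) Fin.zero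
isLast-zero⁺ {w = w} x∉w (Fin.suc k) _ eq = x∉w (subst (_∈ w) eq (∈-lookup k))

isLast-zero⁻ : ∀ {x w} → IsLastOccurrence (x ∷ w) Fin.zero → x ∉ w
isLast-zero⁻ last x∈w = last (Fin.suc (index x∈w)) z<s (sym (lookup-index x∈w))

filter-last-suc : ∀ x w → filter (isLastOccurrence? (x ∷ w)) (map Fin.suc (allFin (length w))) ≡ map Fin.suc (lastIndices w)
filter-last-suc x w = trans (filter-map (isLastOccurrence? (x ∷ w)) Fin.suc (allFin (length w)))
  (cong (map Fin.suc) (filter-≐ _ (isLastOccurrence? w) (isLast-suc⁻ , isLast-suc⁺) (allFin (length w))))

lastIndices-∈ : ∀ {x w} → x ∈ w → lastIndices (x ∷ w) ≡ map Fin.suc (lastIndices w)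
lastIndices-∈ {x} {w} x∈w = trans (cong (filter (isLastOccurrence? (x ∷ w))) (allFin-suc (length w)))
  (trans (filter-reject (isLastOccurrence? (x ∷ w)) (λ last → isLast-zero⁻ {x} {w} last x∈w)) (filter-last-suc x w))

lastIndices-∉ : ∀ {x w} → x ∉ w → lastIndices (x ∷ w) ≡ Fin.zero ∷ map Fin.suc (lastIndices w)
lastIndices-∉ {x} {w} x∉w = trans (cong (filter (isLastOccurrence? (x ∷ w))) (allFin-suc (length w)))
  (trans (filter-accept (isLastOccurrence? (x ∷ w)) (isLast-zero⁺ x∉w)) (cong (Fin.zero ∷_) (filter-last-suc x w)))

lasts≡ : ∀ w → lasts w ≡ map (lookup w) (lastIndices w)
lasts≡ []      = refl
lasts≡ (x ∷ w) with _∈?_ _≟_ x w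
... | yes x∈w = trans (lasts≡ w) (trans (map-∘ (lastIndices w)) (cong (map (lookup (x ∷ w))) (sym (lastIndices-∈ x∈w))))
... | no  x∉w = trans (cong (x ∷_) (trans (lasts≡ w) (map-∘ (lastIndices w)))) (cong (map (lookup (x ∷ w))) (sym (lastIndices-∉ x∉w)))

differences-suc : ∀ p ds → differences (suc p) (map suc ds) ≡ differences p ds
differences-suc p []       = refl
differences-suc p (d ∷ ds) = cong (d ∸ p ∷_) (differences-suc d ds)

differences-increment : ∀ ds → differences 0 (map suc ds) ≡ increment (differences 0 ds)
differences-increment []       = refl
differences-increment (d ∷ ds) = cong (suc d ∷_) (differences-suc d ds)

positions-suc : ∀ {n} (js : List (Fin n)) → map (suc ∘ toℕ) (map Fin.suc js) ≡ map suc (map (suc ∘ toℕ) js)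
positions-suc js = trans (sym (map-∘ js)) (map-∘ js)

-- A letter in front moves every last position by one. An old letter thereby changes only the first
-- difference; a new one contributes the position 1, and the later differences stay the same.
WC≡wc : ∀ w → WC w ≡ wc w
WC≡wc []      = refl
WC≡wc (x ∷ w) with _∈?_ _≟_ x w
... | yes x∈w rewrite lastIndices-∈ x∈w | positions-suc (lastIndices w) =
  trans (differences-increment (lastPositions w)) (cong increment (WC≡wc w))
... | no  x∉w rewrite lastIndices-∉ x∉w | positions-suc (lastIndices w) =
  cong (1 ∷_) (trans (differences-suc 0 (lastPositions w)) (WC≡wc w))

length-filter-cartesianProduct : {A B : Set} {P : A × B → Set} (P? : Decidable P) → ∀ xs ys →
  length (filter P? (cartesianProduct xs ys)) ≡ sum (map (λ x → length (filter (λ y → P? (x , y)) ys)) xs)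
length-filter-cartesianProduct P? []       ys = refl
length-filter-cartesianProduct P? (x ∷ xs) ys = begin
  length (filter P? (map (x ,_) ys ++ cartesianProduct xs ys))
    ≡⟨ cong length (filter-++ P? (map (x ,_) ys) _) ⟩
  length (filter P? (map (x ,_) ys) ++ filter P? (cartesianProduct xs ys))
    ≡⟨ length-++ (filter P? (map (x ,_) ys)) ⟩
  length (filter P? (map (x ,_) ys)) + length (filter P? (cartesianProduct xs ys))
    ≡⟨ cong₂ _+_ (trans (cong length (filter-map P? (x ,_) ys)) (length-map (x ,_) (filter (λ y → P? (x , y)) ys))) (length-filter-cartesianProduct P? xs ys) ⟩
  _ ∎
  where open ≡-Reasoning

-- Pairs are grouped by their left end. Pairs within the tail keep their status, because being a
-- last occurrence concerns only what lies further right.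
sinv≡specialInversions : ∀ w → sinv w ≡ specialInversions w
sinv≡specialInversions []      = refl
sinv≡specialInversions (x ∷ w) = begin
  sinv (x ∷ w)
    ≡⟨ length-filter-cartesianProduct S? (allFin (suc n)) (allFin (suc n)) ⟩
  sum (map row (allFin (suc n)))
    ≡⟨ cong (sum ∘ map row) (allFin-suc n) ⟩
  row Fin.zero + sum (map row (map Fin.suc (allFin n)))
    ≡⟨ cong (λ z → row Fin.zero + sum z) (sym (map-∘ (allFin n))) ⟩
  row Fin.zero + sum (map (row ∘ Fin.suc) (allFin n))
    ≡⟨ cong₂ (λ a b → a + sum b) row-zero (map-cong row-suc (allFin n)) ⟩
  length (filter (_<? x) (lasts w)) + sum (map row′ (allFin n))
    ≡⟨ cong (length (filter (_<? x) (lasts w)) +_) (sym (length-filter-cartesianProduct (specialInversion? w) (allFin n) (allFin n))) ⟩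
  length (filter (_<? x) (lasts w)) + sinv w
    ≡⟨ cong (length (filter (_<? x) (lasts w)) +_) (sinv≡specialInversions w) ⟩
  specialInversions (x ∷ w) ∎
  where
  open ≡-Reasoning
  n = length w
  S? = specialInversion? (x ∷ w)

  row : Fin (suc n) → ℕ
  row i = length (filter (λ j → S? (i , j)) (allFin (suc n)))

  row′ : Fin n → ℕ
  row′ i = length (filter (λ j → specialInversion? w (i , j)) (allFin n))

  row-tail : ∀ i → row i ≡ length (filter (λ j → S? (i , Fin.suc j)) (allFin n))
  row-tail i = begin
    row i ≡⟨ cong (length ∘ filter (λ j → S? (i , j))) (allFin-suc n) ⟩
    length (filter (λ j → S? (i , j)) (Fin.zero ∷ map Fin.suc (allFin n)))
      -- Position 0 is never the right end of an inversion.
      ≡⟨ cong length (filter-reject (λ j → S? (i , j)) {x = Fin.zero} {xs = map Fin.suc (allFin n)} (λ { (() , _) })) ⟩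
    length (filter (λ j → S? (i , j)) (map Fin.suc (allFin n)))
      ≡⟨ cong length (filter-map (λ j → S? (i , j)) Fin.suc (allFin n)) ⟩
    length (map Fin.suc (filter (λ j → S? (i , Fin.suc j)) (allFin n)))
      ≡⟨ length-map Fin.suc (filter (λ j → S? (i , Fin.suc j)) (allFin n)) ⟩
    length (filter (λ j → S? (i , Fin.suc j)) (allFin n)) ∎

  row-suc : ∀ i → row (Fin.suc i) ≡ row′ i
  row-suc i = trans (row-tail (Fin.suc i)) (cong length (filter-≐ _ (λ j → specialInversion? w (i , j))
    ( (λ (i<j , inv , last) → s≤s⁻¹ i<j , inv , isLast-suc⁻ last)
    , (λ (i<j , inv , last) → s<s i<j , inv , isLast-suc⁺ last)) (allFin n)))

  row-zero : row Fin.zero ≡ length (filter (_<? x) (lasts w))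
  row-zero = begin
    row Fin.zero ≡⟨ row-tail Fin.zero ⟩
    length (filter (λ j → S? (Fin.zero , Fin.suc j)) (allFin n))
      ≡⟨ cong length (filter-≐ _ (λ j → (lookup w j <? x) ×-dec isLastOccurrence? w j)
          ((λ (_ , inv , last) → inv , isLast-suc⁻ last) , (λ (inv , last) → z<s , inv , isLast-suc⁺ last)) (allFin n)) ⟩
    length (filter (λ j → (lookup w j <? x) ×-dec isLastOccurrence? w j) (allFin n))
      ≡⟨ cong length (sym (filter-filter (λ j → lookup w j <? x) (isLastOccurrence? w) (allFin n))) ⟩
    length (filter (λ j → lookup w j <? x) (lastIndices w))
      ≡⟨ sym (length-map (lookup w) (filter (λ j → lookup w j <? x) (lastIndices w))) ⟩
    length (map (lookup w) (filter (λ j → lookup w j <? x) (lastIndices w)))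
      ≡⟨ cong length (sym (filter-map (_<? x) (lookup w) (lastIndices w))) ⟩
    length (filter (_<? x) (map (lookup w) (lastIndices w)))
      ≡⟨ cong (length ∘ filter (_<? x)) (sym (lasts≡ w)) ⟩
    length (filter (_<? x) (lasts w)) ∎

-- Standardisation

StrictlyIncreasing : (ℕ → ℕ) → Set
StrictlyIncreasing f = ∀ {x y} → x < y → f x < f y

module _ {f : ℕ → ℕ} (f↑ : StrictlyIncreasing f) where

  increasing-≤ : ∀ {x y} → x ≤ y → f x ≤ f y
  increasing-≤ x≤y with m≤n⇒m<n∨m≡n x≤y
  ... | inj₁ x<y  = <⇒≤ (f↑ x<y)
  ... | inj₂ refl = ≤-refl

  increasing-reflects-≤ : ∀ {x y} → f x ≤ f y → x ≤ y
  increasing-reflects-≤ fx≤fy = ≮⇒≥ λ y<x → <⇒≱ (f↑ y<x) fx≤fy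

  increasing-injective : ∀ {x y} → f x ≡ f y → x ≡ y
  increasing-injective eq = ≤-antisym (increasing-reflects-≤ (≤-reflexive eq)) (increasing-reflects-≤ (≤-reflexive (sym eq)))

  ∈-map-increasing⁻ : ∀ {x w} → f x ∈ map f w → x ∈ w
  ∈-map-increasing⁻ {w = w} fx∈ with y , y∈w , eq ← ∈-map⁻ f fx∈ = subst (_∈ w) (sym (increasing-injective eq)) y∈w

-- `pack w` unfolds to `map (rank w) w`.
rank : Word → ℕ → ℕ
rank w x = length (filter (_≤? x) (deduplicate _≟_ w))

rank-list-unique : ∀ w x → Unique (filter (_≤? x) (deduplicate _≟_ w))
rank-list-unique w x = Unique.filter⁺ (_≤? x) (deduplicate-! _≟_ w)

∈-rank-list⁺ : ∀ {w x y} → y ∈ w → y ≤ x → y ∈ filter (_≤? x) (deduplicate _≟_ w)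
∈-rank-list⁺ {x = x} y∈w y≤x = ∈-filter⁺ (_≤? x) (∈-deduplicate⁺ _≟_ y∈w) y≤x

∈-rank-list⁻ : ∀ {w x y} → y ∈ filter (_≤? x) (deduplicate _≟_ w) → y ∈ w × y ≤ x
∈-rank-list⁻ {w} {x} y∈ = let y∈w , y≤x = ∈-filter⁻ (_≤? x) {xs = deduplicate _≟_ w} y∈ in ∈-deduplicate⁻ _≟_ w y∈w , y≤x

-- A rank may be counted on any convenient list without repetitions, so `deduplicate` never has to
-- be evaluated.
rank≡length : ∀ {w x ys} → Unique ys → (∀ {y} → y ∈ w → y ≤ x → y ∈ ys) → (∀ {y} → y ∈ ys → y ∈ w × y ≤ x) → rank w x ≡ length ys
rank≡length {w} {x} ys! ⊆ ⊇ = ↭-length (unique∧set⇒↭ (rank-list-unique w x) ys!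
  (λ y∈ → let y∈w , y≤x = ∈-rank-list⁻ {w} y∈ in ⊆ y∈w y≤x)
  (λ y∈ → let y∈w , y≤x = ⊇ y∈ in ∈-rank-list⁺ y∈w y≤x))

rank-suc-∈ : ∀ {w x} → suc x ∈ w → rank w (suc x) ≡ suc (rank w x)
rank-suc-∈ {w} {x} sx∈w = rank≡length
  (All.tabulate (λ { y∈ refl → 1+n≰n (proj₂ (∈-rank-list⁻ {w} y∈)) }) ∷ rank-list-unique w x) ⊆ ⊇
  where
  ⊆ : ∀ {y} → y ∈ w → y ≤ suc x → y ∈ suc x ∷ filter (_≤? x) (deduplicate _≟_ w)
  ⊆ y∈w y≤sx with m≤n⇒m<n∨m≡n y≤sx
  ... | inj₁ y<sx = there (∈-rank-list⁺ y∈w (s≤s⁻¹ y<sx))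
  ... | inj₂ refl = here refl

  ⊇ : ∀ {y} → y ∈ suc x ∷ filter (_≤? x) (deduplicate _≟_ w) → y ∈ w × y ≤ suc x
  ⊇ (here refl) = sx∈w , ≤-refl
  ⊇ (there y∈)  = let y∈w , y≤x = ∈-rank-list⁻ {w} y∈ in y∈w , m≤n⇒m≤1+n y≤x

rank-suc-∉ : ∀ {w x} → suc x ∉ w → rank w (suc x) ≡ rank w x
rank-suc-∉ {w} {x} sx∉w = rank≡length (rank-list-unique w x) ⊆
  (λ y∈ → let y∈w , y≤x = ∈-rank-list⁻ {w} y∈ in y∈w , m≤n⇒m≤1+n y≤x)
  where
  ⊆ : ∀ {y} → y ∈ w → y ≤ suc x → y ∈ filter (_≤? x) (deduplicate _≟_ w)
  ⊆ y∈w y≤sx with m≤n⇒m<n∨m≡n y≤sx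
  ... | inj₁ y<sx = ∈-rank-list⁺ y∈w (s≤s⁻¹ y<sx)
  ... | inj₂ refl = contradiction y∈w sx∉w

rank-step : ∀ w x → rank w x ≤ rank w (suc x)
rank-step w x with _∈?_ _≟_ (suc x) w
... | yes sx∈w = ≤-trans (n≤1+n _) (≤-reflexive (sym (rank-suc-∈ sx∈w)))
... | no  sx∉w = ≤-reflexive (sym (rank-suc-∉ sx∉w))

rank-mono : ∀ w {x y} → x ≤ y → rank w x ≤ rank w y
rank-mono w {x} {y} x≤y with m≤n⇒m<n∨m≡n x≤y
... | inj₂ refl = ≤-refl
rank-mono w {x} {suc y} x≤y | inj₁ x<y = ≤-trans (rank-mono w (s≤s⁻¹ x<y)) (rank-step w y)

rank-strict : ∀ {w x y} → y ∈ w → x < y → rank w x < rank w y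
rank-strict {w} {x} {suc y} y∈w x<y = subst (rank w x <_) (sym (rank-suc-∈ y∈w)) (s≤s (rank-mono w (s≤s⁻¹ x<y)))

rank-positive : ∀ {w x} → x ∈ w → 0 < rank w x
rank-positive {w} {x} x∈w with filter (_≤? x) (deduplicate _≟_ w) | ∈-rank-list⁺ {w} x∈w ≤-refl
... | _ ∷ _ | _ = z<s

-- The rank grows by at most one at each step, so it takes all intermediate values, and does so on letters.
rank-surjective : ∀ {w} z {c} → 0 < c → c ≤ rank w z → ∃ λ y → y ∈ w × rank w y ≡ c
rank-surjective {w} zero {c} 0<c c≤ with _∈?_ _≟_ 0 w
... | yes 0∈w = 0 , 0∈w , trans rank≡1 (≤-antisym 0<c (≤-trans c≤ (≤-reflexive rank≡1)))
  where
  rank≡1 : rank w 0 ≡ 1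
  rank≡1 = rank≡length {ys = [ 0 ]} ([] ∷ []) (λ { _ z≤n → here refl }) (λ { (here refl) → 0∈w , z≤n })
... | no  0∉w = contradiction (≤-trans 0<c (≤-trans c≤ (≤-reflexive rank≡0))) λ ()
  where
  rank≡0 : rank w 0 ≡ 0
  rank≡0 = rank≡length {ys = []} [] (λ { 0∈w z≤n → contradiction 0∈w 0∉w }) (λ ())
rank-surjective {w} (suc z) {c} 0<c c≤ with c ≤? rank w z
... | yes c≤rz = rank-surjective z 0<c c≤rz
... | no  c≰rz with _∈?_ _≟_ (suc z) w
...   | yes sz∈w = suc z , sz∈w , ≤-antisym (≤-trans (≤-reflexive (rank-suc-∈ sz∈w)) (≰⇒> c≰rz)) c≤
...   | no  sz∉w = contradiction (≤-trans c≤ (≤-reflexive (rank-suc-∉ sz∉w))) c≰rz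

-- Ranks leave no gaps: below a rank `suc (suc c)`, the value `suc c` is the rank of some letter by
-- `rank-surjective`.
pack-packed : ∀ w → Packed (pack w)
pack-packed w = All.map⁺ (All.tabulate λ {x} x∈w → rank-positive x∈w , predecessor x (rank w x) refl (rank-positive x∈w))
  where
  predecessor : ∀ x c → rank w x ≡ c → 0 < c → c ≡ 1 ⊎ pred c ∈ pack w
  predecessor x (suc zero)    eq _ = inj₁ refl
  predecessor x (suc (suc c)) eq _ with y , y∈w , rank≡ ← rank-surjective {w} x {suc c} z<s (≤-trans (n≤1+n _) (≤-reflexive (sym eq))) =
    inj₂ (subst (_∈ pack w) rank≡ (∈-map⁺ (rank w) y∈w))

-- Ranks depend only on the order of the letters. Hence renumbering a word to make room for a new
-- value does not change how its suffixes pack.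
pack-map : ∀ {f} → StrictlyIncreasing f → ∀ w → pack (map f w) ≡ pack w
pack-map {f} f↑ w = trans (sym (map-∘ w)) (map-cong rank-map w)
  where
  rank-map : ∀ x → rank (map f w) (f x) ≡ rank w x
  rank-map x = trans (rank≡length (Unique.map⁺ (increasing-injective f↑) (rank-list-unique w x)) ⊆ ⊇) (length-map f (filter (_≤? x) (deduplicate _≟_ w)))
    where
    ⊆ : ∀ {y} → y ∈ map f w → y ≤ f x → y ∈ map f (filter (_≤? x) (deduplicate _≟_ w))
    ⊆ y∈ y≤ with z , z∈w , refl ← ∈-map⁻ f y∈ = ∈-map⁺ f (∈-rank-list⁺ z∈w (increasing-reflects-≤ f↑ y≤))

    ⊇ : ∀ {y} → y ∈ map f (filter (_≤? x) (deduplicate _≟_ w)) → y ∈ map f w × y ≤ f x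
    ⊇ y∈ with z , z∈ , refl ← ∈-map⁻ f y∈ = let z∈w , z≤x = ∈-rank-list⁻ {w} z∈ in ∈-map⁺ f z∈w , increasing-≤ f↑ z≤x

packed⇒pack≡ : ∀ {w} → Packed w → pack w ≡ w
packed⇒pack≡ {w} p = trans (map-cong-local (All.tabulate rank≡)) (map-id w)
  where
  r = packed⇒range p

  rank≡ : ∀ {x} → x ∈ w → rank w x ≡ x
  rank≡ {x} x∈w = trans (rank≡length (letters≤-unique x)
    (λ {y} y∈w y≤x → ∈-letters≤⁺ (proj₁ (to (r y) y∈w)) y≤x)
    (λ {y} y∈ → let 0<y , y≤x = ∈-letters≤⁻ y∈ in from (r y) (0<y , ≤-trans y≤x (∈⇒≤maxLetter x∈w)) , y≤x))
    (length-letters≤ x)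

pack-nondecreasing⁺ : ∀ {w} → Linked _≤_ w → Linked _≤_ (pack w)
pack-nondecreasing⁺ {w} l = Linked.map⁺ (Linked.map (rank-mono w) l)

-- The rank increases strictly only on arriving at a letter of `w`, which is why `reflect` carries
-- the membership in `w` along.
pack-nondecreasing⁻ : ∀ {w} → Linked _≤_ (pack w) → Linked _≤_ w
pack-nondecreasing⁻ {w} l = reflect (All.tabulate id) (Linked.map⁻ l)
  where
  reflect : ∀ {u} → All (_∈ w) u → Linked (λ x y → rank w x ≤ rank w y) u → Linked _≤_ u
  reflect _ [] = []
  reflect _ [-] = [-]
  reflect (x∈w ∷ u⊆w) (rx≤ry ∷ l) = ≮⇒≥ (λ y<x → <⇒≱ (rank-strict x∈w y<x) rx≤ry) ∷ reflect u⊆w l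

-- The bound is expressed through `lasts` because `length-wc` ties it to the number of parts of the
-- W-composition.
packed⇒range-lasts : ∀ {w} → Packed w → Range w (length (lasts w))
packed⇒range-lasts {w} p = subst (Range w) (sym (range⇒length-lasts (packed⇒range p))) (packed⇒range p)

module _ {f : ℕ → ℕ} (f↑ : StrictlyIncreasing f) where

  lasts-map : ∀ w → lasts (map f w) ≡ map f (lasts w)
  lasts-map []      = refl
  lasts-map (x ∷ w) with _∈?_ _≟_ (f x) (map f w) | _∈?_ _≟_ x w
  ... | yes _   | yes _   = lasts-map w
  ... | no  _   | no  _   = cong (f x ∷_) (lasts-map w)
  ... | yes fx∈ | no  x∉w = contradiction (∈-map-increasing⁻ f↑ fx∈) x∉w
  ... | no  fx∉ | yes x∈w = contradiction (∈-map⁺ f x∈w) fx∉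

  -- The W-composition sees only which letters are equal, and special inversions see only their
  -- order, so the renumbering caused by a new value affects neither.
  wc-map : ∀ w → wc (map f w) ≡ wc w
  wc-map []      = refl
  wc-map (x ∷ w) with _∈?_ _≟_ (f x) (map f w) | _∈?_ _≟_ x w
  ... | yes _   | yes _   = cong increment (wc-map w)
  ... | no  _   | no  _   = cong (1 ∷_) (wc-map w)
  ... | yes fx∈ | no  x∉w = contradiction (∈-map-increasing⁻ f↑ fx∈) x∉w
  ... | no  fx∉ | yes x∈w = contradiction (∈-map⁺ f x∈w) fx∉

  specialInversions-map : ∀ w → specialInversions (map f w) ≡ specialInversions w
  specialInversions-map []      = refl
  specialInversions-map (x ∷ w) = cong₂ _+_ (begin
    length (filter (_<? f x) (lasts (map f w)))     ≡⟨ cong (length ∘ filter (_<? f x)) (lasts-map w) ⟩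
    length (filter (_<? f x) (map f (lasts w)))     ≡⟨ cong length (filter-map (_<? f x) f (lasts w)) ⟩
    length (map f (filter (λ y → f y <? f x) (lasts w))) ≡⟨ length-map f (filter (λ y → f y <? f x) (lasts w)) ⟩
    length (filter (λ y → f y <? f x) (lasts w))    ≡⟨ cong length (filter-≐ _ (_<? x) ((λ fy<fx → ≰⇒> (λ x≤y → <⇒≱ fy<fx (increasing-≤ f↑ x≤y))) , f↑) (lasts w)) ⟩
    length (filter (_<? x) (lasts w))               ∎) (specialInversions-map w)
    where open ≡-Reasoning

-- Prepending a letter

-- Opening and closing a gap at the value `x`: only with the gap open can `x` be put in front of a
-- packed word as a new value.
shift unshift : ℕ → ℕ → ℕ
shift x y with y <? x
... | yes _ = y
... | no  _ = suc y
unshift x y with y <? x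
... | yes _ = y
... | no  _ = pred y

shift-increasing : ∀ x → StrictlyIncreasing (shift x)
shift-increasing x {y} {z} y<z with y <? x | z <? x
... | yes _   | yes _   = y<z
... | yes _   | no  _   = m<n⇒m<1+n y<z
... | no  _   | no  _   = s<s y<z
... | no  y≮x | yes z<x = contradiction (<-trans y<z z<x) y≮x

shift-≢ : ∀ x y → shift x y ≢ x
shift-≢ x y eq with y <? x
... | yes y<x = <⇒≢ y<x eq
... | no  y≮x = y≮x (≤-reflexive eq)

shift-inflationary : ∀ x y → y ≤ shift x y
shift-inflationary x y with y <? x
... | yes _ = ≤-refl
... | no  _ = n≤1+n y

-- Together with `shift-inflationary` this makes `x ≤ shift x y` equivalent to `x ≤ y`. A block thus
-- stays nondecreasing under the same bound on its new first letter, whether that letter is old or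
-- new.
shift-reflects-≥ : ∀ x y → x ≤ shift x y → x ≤ y
shift-reflects-≥ x y x≤ with y <? x
... | yes _   = x≤
... | no  y≮x = ≮⇒≥ y≮x

shift-< : ∀ x y → shift x y < x → y < x
shift-< x y s<x with y <? x
... | yes y<x = y<x
... | no  _   = <-trans (n<1+n y) s<x

<-shift : ∀ x y → y < x → shift x y < x
<-shift x y y<x with y <? x
... | yes _   = y<x
... | no  y≮x = contradiction y<x y≮x

shift-bounds : ∀ x {y k} → 0 < y × y ≤ k → 0 < shift x y × shift x y ≤ suc k
shift-bounds x {y} (0<y , y≤k) with y <? x
... | yes _ = 0<y , m≤n⇒m≤1+n y≤k
... | no  _ = z<s , s≤s y≤k

unshift-shift : ∀ x y → unshift x (shift x y) ≡ y
unshift-shift x y with y <? x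
... | yes y<x with y <? x
...   | yes _   = refl
...   | no  y≮x = contradiction y<x y≮x
unshift-shift x y | no y≮x with suc y <? x
...   | yes sy<x = contradiction (<-trans (n<1+n y) sy<x) y≮x
...   | no  _    = refl

shift-unshift : ∀ x y → y ≢ x → shift x (unshift x y) ≡ y
shift-unshift x y y≢x with y <? x
shift-unshift x y y≢x | yes y<x with y <? x
... | yes _   = refl
... | no  y≮x = contradiction y<x y≮x
shift-unshift x zero y≢x | no y≮x = contradiction (sym (n≤0⇒n≡0 (≮⇒≥ y≮x))) y≢x
shift-unshift x (suc y) y≢x | no y≮x with y <? x
... | yes y<x = contradiction (≤-antisym y<x (≮⇒≥ y≮x)) y≢x
... | no  _   = refl

∉-map-shift : ∀ x w → x ∉ map (shift x) w
∉-map-shift x w x∈ with y , _ , eq ← ∈-map⁻ (shift x) x∈ = shift-≢ x y (sym eq)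

map-shift-unshift : ∀ {x w} → x ∉ w → map (shift x) (map (unshift x) w) ≡ w
map-shift-unshift {x} {w} x∉w = trans (sym (map-∘ w)) (trans
  (map-cong-local (All.tabulate λ {y} y∈w → shift-unshift x y λ { refl → x∉w y∈w })) (map-id w))

map-unshift-shift : ∀ x w → map (unshift x) (map (shift x) w) ≡ w
map-unshift-shift x w = trans (sym (map-∘ w)) (trans (map-cong (unshift-shift x) w) (map-id w))

range-∷ : ∀ {x w k} → Range w k → 0 < x → x ≤ k → Range (x ∷ w) k
range-∷ r 0<x x≤k y = mk⇔ (λ { (here refl) → 0<x , x≤k ; (there y∈w) → to (r y) y∈w }) (there ∘ from (r y))

range-tail : ∀ {x w k} → Range (x ∷ w) k → x ∈ w → Range w k
range-tail {x} {w} r x∈w y = mk⇔ (to (r y) ∘ there) (tail ∘ from (r y))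
  where
  tail : y ∈ x ∷ w → y ∈ w
  tail (here refl) = x∈w
  tail (there y∈w) = y∈w

range-shift : ∀ {x w k} → Range w k → 0 < x → x ≤ suc k → Range (x ∷ map (shift x) w) (suc k)
range-shift {x} {w} {k} r 0<x x≤sk y = mk⇔ ⇒ ⇐
  where
  ⇒ : y ∈ x ∷ map (shift x) w → 0 < y × y ≤ suc k
  ⇒ (here refl) = 0<x , x≤sk
  ⇒ (there y∈) with z , z∈w , refl ← ∈-map⁻ (shift x) y∈ = shift-bounds x (to (r z) z∈w)

  unshift-bounds : y ≢ x → 0 < y × y ≤ suc k → 0 < unshift x y × unshift x y ≤ k
  unshift-bounds y≢x (0<y , y≤sk) with y <? x
  ... | yes y<x = 0<y , s≤s⁻¹ (≤-trans y<x x≤sk)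
  ... | no  y≮x = ≤-trans 0<x (<⇒≤pred (≤∧≢⇒< (≮⇒≥ y≮x) (y≢x ∘ sym))) , pred-mono-≤ y≤sk

  ⇐ : 0 < y × y ≤ suc k → y ∈ x ∷ map (shift x) w
  ⇐ b with y ≟ x
  ... | yes refl = here refl
  ... | no  y≢x  = there (subst (_∈ map (shift x) w) (shift-unshift x y y≢x) (∈-map⁺ (shift x) (from (r (unshift x y)) (unshift-bounds y≢x b))))

range-unshift : ∀ {x w k} → Range (x ∷ w) (suc k) → x ∉ w → Range (map (unshift x) w) k
range-unshift {x} {w} {k} r x∉w y = mk⇔ ⇒ ⇐
  where
  x-bounds = to (r x) (here refl)

  ⇒ : y ∈ map (unshift x) w → 0 < y × y ≤ k
  ⇒ y∈ with z , z∈w , refl ← ∈-map⁻ (unshift x) y∈ with z <? x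
  ... | yes z<x = proj₁ (to (r z) (there z∈w)) , s≤s⁻¹ (≤-trans z<x (proj₂ x-bounds))
  ... | no  z≮x = ≤-trans (proj₁ x-bounds) (<⇒≤pred (≤∧≢⇒< (≮⇒≥ z≮x) λ { refl → x∉w z∈w })) , pred-mono-≤ (proj₂ (to (r z) (there z∈w)))

  ⇐ : 0 < y × y ≤ k → y ∈ map (unshift x) w
  ⇐ b with from (r (shift x y)) (shift-bounds x b)
  ... | here eq    = contradiction eq (shift-≢ x y)
  ... | there sy∈w = subst (_∈ map (unshift x) w) (unshift-shift x y) (∈-map⁺ (unshift x) sy∈w)

wc-∈ : ∀ {x w} → x ∈ w → wc (x ∷ w) ≡ increment (wc w)
wc-∈ {x} {w} x∈w with _∈?_ _≟_ x w
... | yes _   = refl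
... | no  x∉w = contradiction x∈w x∉w

wc-shift : ∀ x w → wc (x ∷ map (shift x) w) ≡ 1 ∷ wc w
wc-shift x w with _∈?_ _≟_ x (map (shift x) w)
... | yes x∈ = contradiction x∈ (∉-map-shift x w)
... | no  _  = cong (1 ∷_) (wc-map (shift-increasing x) w)

specialInversions-∷ : ∀ {w k} → Range w k → ∀ {x} → x ≤ k → specialInversions (suc x ∷ w) ≡ x + specialInversions w
specialInversions-∷ {w} r x≤k = cong (_+ specialInversions w) (range⇒length-lasts< r x≤k)

-- The gap is opened at `suc x`, so exactly the values 1, ..., x stay below the new letter, just as
-- for an old letter.
specialInversions-shift : ∀ {w k} → Range w k → ∀ {x} → x ≤ k → specialInversions (suc x ∷ map (shift (suc x)) w) ≡ x + specialInversions w
specialInversions-shift {w} r {x} x≤k = cong₂ _+_ (begin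
  length (filter (_<? suc x) (lasts (map s w)))     ≡⟨ cong (length ∘ filter (_<? suc x)) (lasts-map (shift-increasing (suc x)) w) ⟩
  length (filter (_<? suc x) (map s (lasts w)))     ≡⟨ cong length (filter-map (_<? suc x) s (lasts w)) ⟩
  length (map s (filter (λ y → s y <? suc x) (lasts w))) ≡⟨ length-map s (filter (λ y → s y <? suc x) (lasts w)) ⟩
  length (filter (λ y → s y <? suc x) (lasts w))    ≡⟨ cong length (filter-≐ _ (_<? suc x) ((λ {y} → shift-< (suc x) y) , (λ {y} → <-shift (suc x) y)) (lasts w)) ⟩
  length (filter (_<? suc x) (lasts w))             ≡⟨ range⇒length-lasts< r x≤k ⟩
  x                                                 ∎) (specialInversions-map (shift-increasing (suc x)) w)
  where
  open ≡-Reasoning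
  s = shift (suc x)

-- Nondecreasing blocks in front of a packed word

prepend : Word → ℕ → Word
prepend w x = x ∷ map (shift x) w

-- The two bounds differ only for the rightmost letter of a block, where one more choice exists for
-- a new value than for an old one.
extensions : (old new : ℕ) → Word → List Word
extensions a b w = map (_∷ w) (letters≤ a) ++ map (prepend w) (letters≤ b)

-- The inverse of one prepending step: whether the first letter recurs tells which kind of step it
-- was.
unprepend : Word → Word
unprepend []      = []
unprepend (x ∷ w) with _∈?_ _≟_ x w
... | yes _ = w
... | no  _ = map (unshift x) w

unprepend-∈ : ∀ {x w} → x ∈ w → unprepend (x ∷ w) ≡ w
unprepend-∈ {x} {w} x∈w with _∈?_ _≟_ x w
... | yes _   = refl
... | no  x∉w = contradiction x∈w x∉w

unprepend-∉ : ∀ {x w} → x ∉ w → unprepend (x ∷ w) ≡ map (unshift x) w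
unprepend-∉ {x} {w} x∉w with _∈?_ _≟_ x w
... | yes x∈w = contradiction x∈w x∉w
... | no  _   = refl

-- A common view of the two kinds of step, with `relabel` the identity for an old value and a
-- `shift` for a new one, so that the conditions on a block are checked only once.
record Prepended (w z : Word) : Set where
  field
    {letter}     : ℕ
    {relabel}    : ℕ → ℕ
    increasing   : StrictlyIncreasing relabel
    inflationary : ∀ y → y ≤ relabel y
    reflects     : ∀ y → letter ≤ relabel y → letter ≤ y
    shape        : z ≡ letter ∷ map relabel w

open Prepended

prepended-old : ∀ {x w} → Prepended w (x ∷ w)
prepended-old {x} {w} = record { increasing = id ; inflationary = λ _ → ≤-refl ; reflects = λ _ → id ; shape = cong (x ∷_) (sym (map-id w)) }

prepended-new : ∀ {x w} → Prepended w (prepend w x)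
prepended-new {x} = record { increasing = shift-increasing x ; inflationary = shift-inflationary x ; reflects = shift-reflects-≥ x ; shape = refl }

module _ {w k} (r : Range w k) {a b} (a≤k : a ≤ k) (b≤sk : b ≤ suc k) where

  ∈-extensions⁻ : ∀ {z} → z ∈ extensions a b w →
    Packed z × unprepend z ≡ w × Σ (Prepended w z) λ p → letter p ≤ a ⊎ letter p ≤ b
  ∈-extensions⁻ z∈ with ∈-++⁻ (map (_∷ w) (letters≤ a)) z∈
  ... | inj₁ z∈old with x , x∈ , refl ← ∈-map⁻ (_∷ w) z∈old with 0<x , x≤a ← ∈-letters≤⁻ x∈ =
    range⇒packed (range-∷ r 0<x x≤k) , unprepend-∈ (from (r x) (0<x , x≤k)) , prepended-old , inj₁ x≤a
    where x≤k = ≤-trans x≤a a≤k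
  ... | inj₂ z∈new with x , x∈ , refl ← ∈-map⁻ (prepend w) z∈new with 0<x , x≤b ← ∈-letters≤⁻ x∈ =
    range⇒packed (range-shift r 0<x (≤-trans x≤b b≤sk)) , trans (unprepend-∉ (∉-map-shift x w)) (map-unshift-shift x w) , prepended-new , inj₂ x≤b

  extensions-unique : Unique (extensions a b w)
  extensions-unique = Unique.++⁺
    (Unique.map⁺ ∷-injectiveˡ (letters≤-unique a))
    (Unique.map⁺ ∷-injectiveˡ (letters≤-unique b)) disjoint
    where
    disjoint : ∀ {z} → z ∈ map (_∷ w) (letters≤ a) × z ∈ map (prepend w) (letters≤ b) → _
    disjoint (z∈old , z∈new) with x , x∈ , refl ← ∈-map⁻ (_∷ w) z∈old with x′ , _ , eq ← ∈-map⁻ (prepend w) z∈new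
      with refl ← ∷-injectiveˡ eq with 0<x , x≤a ← ∈-letters≤⁻ x∈ =
      ∉-map-shift x w (subst (x ∈_) (∷-injectiveʳ eq) (from (r x) (0<x , ≤-trans x≤a a≤k)))

-- The premise on `a` is an implication because at the rightmost letter of a block `a` is the number
-- of values already present, a bound that a new letter may exceed by one.
packed-∷⁻ : ∀ {x t} → Packed (x ∷ t) → let w = unprepend (x ∷ t) in
  Packed w × Prepended w (x ∷ t) × x ≤ suc (length (lasts w)) ×
  (∀ {a b} → (x ≤ length (lasts w) → x ≤ a) → x ≤ b → x ∷ t ∈ extensions a b w)
packed-∷⁻ {x} {t} p with _∈?_ _≟_ x t | packed⇒range p
... | yes x∈t | r = range⇒packed r′ , prepended-old , m≤n⇒m≤1+n x≤k ,
  λ x≤a _ → ∈-++⁺ˡ (∈-map⁺ (_∷ t) (∈-letters≤⁺ (proj₁ (to (r x) (here refl))) (x≤a x≤k)))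
  where
  r′ = range-tail r x∈t
  x≤k : x ≤ length (lasts t)
  x≤k = ≤-trans (proj₂ (to (r′ x) x∈t)) (≤-reflexive (sym (range⇒length-lasts r′)))
... | no  x∉t | r with maxLetter (x ∷ t)
...   | zero  = contradiction (≤-trans (proj₁ (to (r x) (here refl))) (proj₂ (to (r x) (here refl)))) λ ()
...   | suc k = range⇒packed r′ , subst (λ u → Prepended w (x ∷ u)) (map-shift-unshift x∉t) prepended-new ,
  ≤-trans (proj₂ (to (r x) (here refl))) (≤-reflexive (cong suc (sym (range⇒length-lasts r′)))) ,
  λ _ x≤b → ∈-++⁺ʳ (map (_∷ _) (letters≤ _)) (subst (λ u → x ∷ u ∈ map (prepend w) (letters≤ _)) (map-shift-unshift x∉t)
    (∈-map⁺ (prepend w) (∈-letters≤⁺ (proj₁ (to (r x) (here refl))) x≤b)))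
  where
  w = map (unshift x) t
  r′ = range-unshift r x∉t

firstLetter : Word → ℕ
firstLetter []      = 0
firstLetter (x ∷ _) = x

grow : Word → List Word
grow w = extensions (firstLetter w) (firstLetter w) w

-- The rightmost letter of a block is limited only by the values available, every other letter by
-- its right neighbour; hence the separate case of length 1.
prefixed : ℕ → Word → List Word
prefixed zero          v = [ v ]
prefixed (suc zero)    v = extensions (length (lasts v)) (suc (length (lasts v))) v
prefixed (suc (suc j)) v = concatMap grow (prefixed (suc j) v)

-- What it means for M_w to occur in the product of `αS j` with M_v, stated on bare words.
record Prefixed (j : ℕ) (v w : Word) : Set where
  constructor prefixed-by
  field
    isPacked       : Packed w
    hasLength      : length w ≡ j + length v
    nondecreasing  : Linked _≤_ (take j w)
    packsTo        : pack (drop j w) ≡ v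

open Prefixed

length-prepended : ∀ {w z} → Prepended w z → length z ≡ suc (length w)
length-prepended {w} p rewrite shape p = cong suc (length-map (relabel p) w)

pack-prepended : ∀ {w z} → Prepended w z → ∀ j → pack (drop (suc j) z) ≡ pack (drop j w)
pack-prepended {w} p j rewrite shape p = trans (cong pack (drop-map {f = relabel p} j w)) (pack-map (increasing p) (drop j w))

nondecreasing-prepended⁺ : ∀ {w z} (p : Prepended w z) → ∀ j → letter p ≤ firstLetter w → Linked _≤_ (take j w) → Linked _≤_ (take (suc j) z)
nondecreasing-prepended⁺ {w} p j x≤ l rewrite shape p | take-map {f = relabel p} j w = go (take j w) (lemma j w x≤) (Linked.map⁺ (Linked.map (increasing-≤ (increasing p)) l))
  where
  lemma : ∀ j w → letter p ≤ firstLetter w → take j w ≡ [] ⊎ letter p ≤ firstLetter (take j w)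
  lemma zero    w       _  = inj₁ refl
  lemma (suc j) []      _  = inj₁ refl
  lemma (suc j) (x ∷ w) x≤ = inj₂ x≤

  go : ∀ u → u ≡ [] ⊎ letter p ≤ firstLetter u → Linked _≤_ (map (relabel p) u) → Linked _≤_ (letter p ∷ map (relabel p) u)
  go []      _         _ = [-]
  go (y ∷ u) (inj₂ x≤) l = ≤-trans x≤ (inflationary p y) ∷ l

nondecreasing-prepended⁻ : ∀ {w z} (p : Prepended w z) → ∀ j → Linked _≤_ (take (suc j) z) → Linked _≤_ (take j w)
nondecreasing-prepended⁻ {w} p j l rewrite shape p | take-map {f = relabel p} j w = Linked.map (increasing-reflects-≤ (increasing p)) (Linked.map⁻ (Linked.tail l))

letter≤firstLetter : ∀ {y u z} (p : Prepended (y ∷ u) z) → ∀ j → Linked _≤_ (take (suc (suc j)) z) → letter p ≤ y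
letter≤firstLetter {y} p j l rewrite shape p with x≤ ∷ _ ← l = reflects p y x≤

firstLetter≤ : ∀ {w k} → Range w k → firstLetter w ≤ k
firstLetter≤ {[]}    r = z≤n
firstLetter≤ {x ∷ w} r = proj₂ (to (r x) (here refl))

grow-prefixed : ∀ {j v w z} → Prefixed (suc j) v w → z ∈ grow w → Prefixed (suc (suc j)) v z
grow-prefixed {j} w-prefixed z∈
  with r ← packed⇒range-lasts (isPacked w-prefixed)
  with z-packed , _ , p , x≤ ← ∈-extensions⁻ r (firstLetter≤ r) (m≤n⇒m≤1+n (firstLetter≤ r)) z∈ =
  prefixed-by z-packed (trans (length-prepended p) (cong suc (hasLength w-prefixed)))
    (nondecreasing-prepended⁺ p (suc j) (reduce x≤) (nondecreasing w-prefixed))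
    (trans (pack-prepended p (suc j)) (packsTo w-prefixed))

prefixed-unprepend : ∀ {j v z} → Prefixed (suc (suc j)) v z → Prefixed (suc j) v (unprepend z) × z ∈ grow (unprepend z)
prefixed-unprepend {j} {v} {x ∷ t} z-prefixed with unprepend (x ∷ t) | packed-∷⁻ (isPacked z-prefixed)
... | w | w-packed , p , x≤ , ∈ext = w-prefixed , ∈ext (λ _ → x≤first) x≤first
  where
  length-w : length w ≡ suc (j + length v)
  length-w = suc-injective (trans (sym (length-prepended p)) (hasLength z-prefixed))

  w-prefixed : Prefixed (suc j) v w
  w-prefixed = prefixed-by w-packed length-w (nondecreasing-prepended⁻ p (suc j) (nondecreasing z-prefixed))
    (trans (sym (pack-prepended p (suc j))) (packsTo z-prefixed))

  -- The block has at least two letters, so `x` has a right neighbour inside it that bounds it.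
  nonempty : ∀ w (p : Prepended w (x ∷ t)) → length w ≡ suc (j + length v) → letter p ≤ firstLetter w
  nonempty (y ∷ w) p _ = letter≤firstLetter p j (nondecreasing z-prefixed)

  x≤first : x ≤ firstLetter w
  x≤first = subst (_≤ firstLetter w) (sym (∷-injectiveˡ (shape p))) (nonempty w p length-w)

module _ {v : Word} (v-packed : Packed v) where

  ∈-prefixed⁻ : ∀ j {w} → w ∈ prefixed j v → Prefixed j v w
  ∈-prefixed⁻ zero (here refl) = prefixed-by v-packed refl [] (packed⇒pack≡ v-packed)
  ∈-prefixed⁻ (suc zero) w∈ with z-packed , _ , p , _ ← ∈-extensions⁻ (packed⇒range-lasts v-packed) ≤-refl ≤-refl w∈ =
    prefixed-by z-packed (length-prepended p) (singleton _) (trans (pack-prepended p 0) (packed⇒pack≡ v-packed))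
    where
    singleton : ∀ z → Linked _≤_ (take 1 z)
    singleton []      = []
    singleton (x ∷ z) = [-]
  ∈-prefixed⁻ (suc (suc j)) z∈ =
    let w , w∈ , z∈grow = find (∈-concatMap⁻ grow {xs = prefixed (suc j) v} z∈) in grow-prefixed (∈-prefixed⁻ (suc j) w∈) z∈grow

  ∈-prefixed⁺ : ∀ j {w} → Prefixed j v w → w ∈ prefixed j v
  ∈-prefixed⁺ zero w-prefixed = here (trans (sym (packed⇒pack≡ (isPacked w-prefixed))) (packsTo w-prefixed))
  ∈-prefixed⁺ (suc zero) {x ∷ t} z-prefixed with w-packed , p , x≤ , ∈ext ← packed-∷⁻ (isPacked z-prefixed) =
    subst (λ u → x ∷ t ∈ extensions (length (lasts u)) (suc (length (lasts u))) u) w≡v (∈ext id x≤)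
    where
    w≡v : unprepend (x ∷ t) ≡ v
    w≡v = trans (sym (packed⇒pack≡ w-packed)) (trans (sym (pack-prepended p 0)) (packsTo z-prefixed))
  ∈-prefixed⁺ (suc (suc j)) z-prefixed =
    let w-prefixed , z∈ = prefixed-unprepend z-prefixed in ∈-concatMap⁺ grow (lose (∈-prefixed⁺ (suc j) w-prefixed) z∈)

  prefixed-unique : ∀ j → Unique (prefixed j v)
  prefixed-unique zero          = [] ∷ []
  prefixed-unique (suc zero)    = extensions-unique (packed⇒range-lasts v-packed) ≤-refl (≤-refl {suc (length (lasts v))})
  prefixed-unique (suc (suc j)) = concatMap-unique grow unprepend (prefixed-unique (suc j))
    (λ w∈ → let r = range w∈ in extensions-unique r (firstLetter≤ r) (m≤n⇒m≤1+n (firstLetter≤ r)))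
    (λ w∈ z∈ → let r = range w∈ in proj₁ (proj₂ (∈-extensions⁻ r (firstLetter≤ r) (m≤n⇒m≤1+n (firstLetter≤ r)) z∈)))
    where
    range : ∀ {w} → w ∈ prefixed (suc j) v → Range w (length (lasts w))
    range w∈ = packed⇒range-lasts (isPacked (∈-prefixed⁻ (suc j) w∈))

-- Enumerations

∈-words⁺ : ∀ m n {w} → length w ≡ n → All (λ x → 0 < x × x ≤ m) w → w ∈ words m n
∈-words⁺ m zero    {[]}    _  _              = here refl
∈-words⁺ m (suc n) {x ∷ w} eq ((0<x , x≤m) ∷ b) = ∈-cartesianProductWith⁺ _∷_ (∈-letters≤⁺ 0<x x≤m) (∈-words⁺ m n (suc-injective eq) b)

∈-words⁻ : ∀ m n {w} → w ∈ words m n → length w ≡ n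
∈-words⁻ m zero    (here refl) = refl
∈-words⁻ m (suc n) w∈ with _ , _ , _ , w∈ , refl ← ∈-cartesianProductWith⁻ _∷_ (letters≤ m) (words m n) w∈ = cong suc (∈-words⁻ m n w∈)

words-unique : ∀ m n → Unique (words m n)
words-unique m zero    = [] ∷ []
words-unique m (suc n) = Unique.cartesianProductWith⁺ _∷_ ∷-injective (letters≤-unique m) (words-unique m n)

letters-packedWords : ∀ n → map letters (packedWords n) ≡ filter packed? (words n n)
letters-packedWords n = go (words n n)
  where
  go : ∀ ws → map letters (mapMaybe (λ w → Maybe.map (λ p → ⟨ w , p ⟩) (dec⇒maybe (packed? w))) ws) ≡ filter packed? ws
  go []       = refl
  go (w ∷ ws) with packed? w
  ... | yes _ = cong (w ∷_) (go ws)
  ... | no  _ = go ws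

letters-injective : ∀ {u v} → letters u ≡ letters v → u ≡ v
letters-injective refl = refl

packedWords-unique : ∀ n → Unique (packedWords n)
packedWords-unique n = Unique.map⁻ {f = letters} (subst Unique (sym (letters-packedWords n)) (Unique.filter⁺ packed? (words-unique n n)))

-- The proof stored in a `PackedWord` is irrelevant; decidability of `Packed` gives it back.
letters-packed : ∀ u → Packed (letters u)
letters-packed ⟨ w , p ⟩ = recompute (packed? w) p

∈-packedWords⁻ : ∀ n {u} → u ∈ packedWords n → length (letters u) ≡ n
∈-packedWords⁻ n {u} u∈ = ∈-words⁻ n n (proj₁ (∈-filter⁻ packed? {xs = words n n} (subst (letters u ∈_) (letters-packedWords n) (∈-map⁺ letters u∈))))

∈-packedWords⁺ : ∀ n u → length (letters u) ≡ n → u ∈ packedWords n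
∈-packedWords⁺ n u eq = find-letters (∈-map⁻ letters (subst (letters u ∈_) (sym (letters-packedWords n)) (∈-filter⁺ packed? (∈-words⁺ n n eq bounds) p)))
  where
  p = letters-packed u

  -- A packed word has at most as many values as letters, so it fits into the alphabet of
  -- `words n n`.
  bounds : All (λ x → 0 < x × x ≤ n) (letters u)
  bounds = All.tabulate λ {x} x∈ → let 0<x , x≤k = to (packed⇒range-lasts p x) x∈ in
    0<x , ≤-trans x≤k (≤-trans (length-lasts (letters u)) (≤-reflexive eq))

  find-letters : (∃ λ u′ → u′ ∈ packedWords n × letters u ≡ letters u′) → u ∈ packedWords n
  find-letters (u′ , u′∈ , eq′) = subst (_∈ packedWords n) (sym (letters-injective {u} {u′} eq′)) u′∈

packWord : Word → PackedWord
packWord w = ⟨ pack w , pack-packed w ⟩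

product : ℕ → PackedWord → List PackedWord
product j v = concatMap (λ u → convolution u v) (nondecreasingPackedWords j)

∈-nondecreasing⁻ : ∀ {j u} → u ∈ nondecreasingPackedWords j → length (letters u) ≡ j × Linked _≤_ (letters u)
∈-nondecreasing⁻ {j} u∈ with u∈ , l ← ∈-filter⁻ (λ u → linked? _≤?_ (letters u)) {xs = packedWords j} u∈ = ∈-packedWords⁻ j u∈ , l

∈-convolution⁻ : ∀ u v {w} → w ∈ convolution u v → let a = length (letters u) in
  length (letters w) ≡ a + length (letters v) × pack (take a (letters w)) ≡ letters u × pack (drop a (letters w)) ≡ letters v
∈-convolution⁻ u v w∈ with w∈ , c ← ∈-filter⁻ _ {xs = packedWords (length (letters u) + length (letters v))} w∈ = ∈-packedWords⁻ _ w∈ , c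

convolution-unique : ∀ u v → Unique (convolution u v)
convolution-unique u v = Unique.filter⁺ _ (packedWords-unique (length (letters u) + length (letters v)))

-- The left factor `u` can be read off from a term as the packing of its first `j` letters, so terms
-- from different `u` never coincide.
product-unique : ∀ j v → Unique (product j v)
product-unique j v = concatMap-unique (λ u → convolution u v) (λ w → packWord (take j (letters w)))
  (Unique.filter⁺ _ (packedWords-unique j)) (λ {u} _ → convolution-unique u v)
  (λ {u} u∈ w∈ → letters-injective (section (proj₁ (∈-nondecreasing⁻ {j} u∈)) (proj₁ (proj₂ (∈-convolution⁻ u v w∈)))))
  where
  section : ∀ {a w u} → a ≡ j → pack (take a w) ≡ u → pack (take j w) ≡ u
  section refl eq = eq

∈-product⁻ : ∀ j v {w} → w ∈ product j v → Prefixed j (letters v) (letters w)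
∈-product⁻ j v {w} w∈ with u , u∈ , w∈ ← find (∈-concatMap⁻ (λ u → convolution u v) {xs = nondecreasingPackedWords j} w∈)
  with refl , u-nondecreasing ← ∈-nondecreasing⁻ {j} u∈
  with len , take≡ , drop≡ ← ∈-convolution⁻ u v w∈ =
  prefixed-by (letters-packed w) len (pack-nondecreasing⁻ (subst (Linked _≤_) (sym take≡) u-nondecreasing)) drop≡

∈-product⁺ : ∀ j v {w} → Prefixed j (letters v) (letters w) → w ∈ product j v
∈-product⁺ j v {w} w-prefixed = ∈-concatMap⁺ (λ u → convolution u v) (lose {x = u}
  (∈-filter⁺ _ (∈-packedWords⁺ j u len-u) (pack-nondecreasing⁺ (nondecreasing w-prefixed)))
  (∈-filter⁺ _ (∈-packedWords⁺ _ w (trans (hasLength w-prefixed) (cong (_+ length (letters v)) (sym len-u))))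
    (cong (λ a → pack (take a (letters w))) len-u , trans (cong (λ a → pack (drop a (letters w))) len-u) (packsTo w-prefixed))))
  where
  u = packWord (take j (letters w))
  len-u : length (letters u) ≡ j
  len-u = trans (length-map _ (take j (letters w))) (trans (length-take j (letters w)) (m≤n⇒m⊓n≡m (≤-trans (m≤m+n j _) (≤-reflexive (sym (hasLength w-prefixed))))))

-- Both lists are free of repetitions and have the same members, described by `Prefixed`. This
-- passes from the definition of the product to an enumeration that can be summed letter by letter.
product-↭-prefixed : ∀ j v → map letters (product j v) ↭ prefixed j (letters v)
product-↭-prefixed j v = unique∧set⇒↭ (Unique.map⁺ letters-injective (product-unique j v)) (prefixed-unique v-packed j)
  ⊆ (λ z∈ → ⊇ (∈-prefixed⁻ v-packed j z∈))
  where
  v-packed = letters-packed v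

  ⊆ : ∀ {z} → z ∈ map letters (product j v) → z ∈ prefixed j (letters v)
  ⊆ z∈ with w , w∈ , refl ← ∈-map⁻ letters z∈ = ∈-prefixed⁺ v-packed j (∈-product⁻ j v w∈)

  ⊇ : ∀ {z} → Prefixed j (letters v) z → z ∈ map letters (product j v)
  ⊇ {z} z-prefixed = ∈-map⁺ letters (∈-product⁺ j v {⟨ z , isPacked z-prefixed ⟩} z-prefixed)

-- Compositions

∈-compositions⁺ : ∀ n {I} → I ⊨ n → I ∈ compositions n
∈-compositions⁺ zero    {[]} _ = here refl
∈-compositions⁺ zero    {suc i ∷ I} (_ , ())
∈-compositions⁺ zero    {zero ∷ I} ((() ∷ _) , _)
∈-compositions⁺ (suc n) {zero ∷ I} ((() ∷ _) , _)
∈-compositions⁺ (suc n) {suc zero ∷ []} (_ ∷ _ , eq) = ∈-concatMap⁺ _ (lose {x = []} (∈-compositions⁺ n ([] , suc-injective eq)) (here refl))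
∈-compositions⁺ (suc n) {suc zero ∷ i ∷ I} (_ ∷ ps , eq) = ∈-concatMap⁺ _ (lose {x = i ∷ I} (∈-compositions⁺ n (ps , suc-injective eq)) (here refl))
∈-compositions⁺ (suc n) {suc (suc i) ∷ I} (_ ∷ ps , eq) = ∈-concatMap⁺ _ (lose {x = suc i ∷ I} (∈-compositions⁺ n (z<s ∷ ps , suc-injective eq)) (there (here refl)))

-- It undoes what one more letter in front does to a W-composition, and it is also the retraction
-- that keeps `compositions` free of repetitions.
removeCell : List ℕ → List ℕ
removeCell []                = []
removeCell (zero ∷ I)        = I
removeCell (suc zero ∷ I)    = I
removeCell (suc (suc i) ∷ I) = suc i ∷ I

∈-compositions⁻ : ∀ n {I} → I ∈ compositions n → I ⊨ n
∈-compositions⁻ zero    (here refl) = [] , refl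
∈-compositions⁻ (suc n) I∈ with find (∈-concatMap⁻ _ {xs = compositions n} I∈)
... | []    , I′∈ , here refl = z<s ∷ [] , cong suc (proj₂ (∈-compositions⁻ n I′∈))
... | i ∷ I , I′∈ , I∈extend with ∈-compositions⁻ n I′∈ | I∈extend
...   | ps     , eq | here refl         = z<s ∷ ps , cong suc eq
...   | _ ∷ ps , eq | there (here refl) = z<s ∷ ps , cong suc eq

compositions-unique : ∀ n → Unique (compositions n)
compositions-unique zero    = [] ∷ []
compositions-unique (suc n) = concatMap-unique _ removeCell (compositions-unique n) (λ {I} _ → extend-unique I) (λ I∈ → section (proj₁ (∈-compositions⁻ n I∈)))
  where
  extend-unique : ∀ I → Unique _
  extend-unique []      = [] ∷ []
  extend-unique (i ∷ I) = ((λ ()) ∷ []) ∷ [] ∷ []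

  section : ∀ {I} → All (0 <_) I → ∀ {I′} → I′ ∈ _ → removeCell I′ ≡ I
  section {[]}        _ (here refl)         = refl
  section {i ∷ I}     _ (here refl)         = refl
  section {zero ∷ I}  (() ∷ _) (there (here refl))
  section {suc i ∷ I} _ (there (here refl)) = refl

removeCell-positive : ∀ {I} → All (0 <_) I → All (0 <_) (removeCell I)
removeCell-positive {[]}             []       = []
removeCell-positive {suc zero ∷ I}    (_ ∷ ps) = ps
removeCell-positive {suc (suc i) ∷ I} (_ ∷ ps) = z<s ∷ ps

sum-removeCell : ∀ {I n} → I ⊨ suc n → sum (removeCell I) ≡ n
sum-removeCell {zero ∷ I}        ((() ∷ _) , _)
sum-removeCell {suc zero ∷ I}    (_ , eq) = suc-injective eq
sum-removeCell {suc (suc i) ∷ I} (_ , eq) = suc-injective eq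

removeCells-zero : ∀ {I} → All (0 <_) I → removeCells 0 I ≡ I
removeCells-zero {[]}    []       = refl
removeCells-zero {i ∷ I} (p ∷ ps) with 0 <? i
... | yes _  = refl
... | no 0≮i = contradiction p 0≮i

removeCells-suc : ∀ j {I} → All (0 <_) I → removeCells (suc j) I ≡ removeCells j (removeCell I)
removeCells-suc j {[]}              _ = refl
removeCells-suc j {zero ∷ I}        (() ∷ _)
removeCells-suc j {suc zero ∷ I}    _ with suc j <? 1
... | yes (s≤s ())
... | no  _ = refl
removeCells-suc j {suc (suc i) ∷ I} _ with suc j <? suc (suc i) | j <? suc i
... | yes _ | yes _ = refl
... | no  _ | no  _ = refl
... | yes p | no ¬p = contradiction (s≤s⁻¹ p) ¬p
... | no ¬p | yes p = contradiction (s≤s p) ¬p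

removeCells-⊨ : ∀ j {I n} → I ⊨ n → j ≤ n → removeCells j I ⊨ n ∸ j
removeCells-⊨ zero            (I+ , eq) _         rewrite removeCells-zero I+ = I+ , eq
removeCells-⊨ (suc j) {n = suc n} (I+ , eq) (s≤s j≤n) rewrite removeCells-suc j I+ =
  removeCells-⊨ j (removeCell-positive I+ , sum-removeCell (I+ , eq)) j≤n

-- The source of rule (i): the cut falls at or beyond the end of the first row, so where that row
-- ends is no longer visible.
removeCells-mergeFirstTwo : ∀ j {i₁} i₂ I → i₁ ≤ j → removeCells j (i₁ ∷ i₂ ∷ I) ≡ removeCells j (i₁ + i₂ ∷ I)
removeCells-mergeFirstTwo j {i₁} i₂ I i₁≤j with j <? i₁
... | yes j<i₁ = contradiction i₁≤j (<⇒≱ j<i₁)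
-- Of the `j = i₁ + d` cells, `d` are left for the second row.
... | no  _ with d , refl ← m≤n⇒∃[o]m+o≡n i₁≤j rewrite m+n∸m≡n i₁ d
  with d <? i₂ | i₁ + d <? i₁ + i₂
...   | yes _    | yes _ = cong (_∷ I) (sym ([m+n]∸[m+o]≡n∸o i₁ i₂ d))
...   | no  _    | no  _ = cong (λ m → removeCells m I) (sym ([m+n]∸[m+o]≡n∸o i₁ d i₂))
...   | yes d<i₂ | no ≮  = contradiction (+-monoʳ-< i₁ d<i₂) ≮
...   | no  d≮i₂ | yes < = contradiction (+-cancelˡ-< i₁ d i₂ <) d≮i₂

length-removeCells : ∀ {j i} I → j < i → length (removeCells j (i ∷ I)) ≡ suc (length I)
length-removeCells {j} {i} I j<i with j <? i
... | yes _   = refl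
... | no  j≮i = contradiction j<i j≮i

-- Formal sums

module _ {c ℓ} (K : GroundRing c ℓ) where

  open NoncommutativeSymmetricFunctions K
  private module R = GroundRing K
  open RingSolver R.commutativeSemiring using (solve; _:=_; _:+_; _:*_)
  open SetoidReasoning R.setoid

  private variable
    a b : Level
    A : Set a
    B : Set b
    X Y Z : Set

  ∑ᴷ : List A → (A → Carrier) → Carrier
  ∑ᴷ []       f = 0#
  ∑ᴷ (x ∷ xs) f = f x +ᴷ ∑ᴷ xs f

  ∑ᴷ-cong : ∀ (xs : List A) {f g} → (∀ {x} → x ∈ xs → f x ≈ᴷ g x) → ∑ᴷ xs f ≈ᴷ ∑ᴷ xs g
  ∑ᴷ-cong []       eq = R.refl
  ∑ᴷ-cong (x ∷ xs) eq = R.+-cong (eq (here refl)) (∑ᴷ-cong xs (eq ∘ there))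

  ∑ᴷ-zero : ∀ (xs : List A) {f} → (∀ {x} → x ∈ xs → f x ≈ᴷ 0#) → ∑ᴷ xs f ≈ᴷ 0#
  ∑ᴷ-zero []       eq = R.refl
  ∑ᴷ-zero (x ∷ xs) eq = R.trans (R.+-cong (eq (here refl)) (∑ᴷ-zero xs (eq ∘ there))) (R.+-identityˡ 0#)

  ∑ᴷ-++ : ∀ (xs : List A) {ys f} → ∑ᴷ (xs ++ ys) f ≈ᴷ ∑ᴷ xs f +ᴷ ∑ᴷ ys f
  ∑ᴷ-++ []       = R.sym (R.+-identityˡ _)
  ∑ᴷ-++ (x ∷ xs) = R.trans (R.+-congˡ (∑ᴷ-++ xs)) (R.sym (R.+-assoc _ _ _))

  ∑ᴷ-map : ∀ (g : A → B) xs {f} → ∑ᴷ (map g xs) f ≡ ∑ᴷ xs (f ∘ g)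
  ∑ᴷ-map g []       = refl
  ∑ᴷ-map g (x ∷ xs) = cong (_ +ᴷ_) (∑ᴷ-map g xs)

  ∑ᴷ-concatMap : ∀ (g : A → List B) xs {f} → ∑ᴷ (concatMap g xs) f ≈ᴷ ∑ᴷ xs (λ x → ∑ᴷ (g x) f)
  ∑ᴷ-concatMap g []       = R.refl
  ∑ᴷ-concatMap g (x ∷ xs) = R.trans (∑ᴷ-++ (g x)) (R.+-congˡ (∑ᴷ-concatMap g xs))

  ∑ᴷ-*ˡ : ∀ (xs : List A) r {f} → ∑ᴷ xs (λ x → r * f x) ≈ᴷ r * ∑ᴷ xs f
  ∑ᴷ-*ˡ []       r = R.sym (R.zeroʳ r)
  ∑ᴷ-*ˡ (x ∷ xs) r = R.trans (R.+-congˡ (∑ᴷ-*ˡ xs r)) (R.sym (R.distribˡ r _ _))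

  ∑ᴷ-+ : ∀ (xs : List A) {f g} → ∑ᴷ xs (λ x → f x +ᴷ g x) ≈ᴷ ∑ᴷ xs f +ᴷ ∑ᴷ xs g
  ∑ᴷ-+ []       = R.sym (R.+-identityˡ 0#)
  ∑ᴷ-+ (x ∷ xs) {f} {g} = R.trans (R.+-congˡ (∑ᴷ-+ xs))
    (solve 4 (λ a b c d → (a :+ b) :+ (c :+ d) := (a :+ c) :+ (b :+ d)) R.refl (f x) (g x) (∑ᴷ xs f) (∑ᴷ xs g))

  ∑ᴷ-swap : ∀ (xs : List A) (ys : List B) {f : A → B → Carrier} → ∑ᴷ xs (λ x → ∑ᴷ ys (f x)) ≈ᴷ ∑ᴷ ys (λ y → ∑ᴷ xs (λ x → f x y))
  ∑ᴷ-swap []       ys = R.sym (∑ᴷ-zero ys (λ _ → R.refl))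
  ∑ᴷ-swap (x ∷ xs) ys = R.trans (R.+-congˡ (∑ᴷ-swap xs ys)) (R.sym (∑ᴷ-+ ys))

  ∑ᴷ-↭ : ∀ {xs ys : List A} {f} → xs ↭ ys → ∑ᴷ xs f ≈ᴷ ∑ᴷ ys f
  ∑ᴷ-↭ ↭.refl          = R.refl
  ∑ᴷ-↭ (↭.prep x p)    = R.+-congˡ (∑ᴷ-↭ p)
  ∑ᴷ-↭ {f = f} (↭.swap {xs = xs} {ys} x y p) = R.trans (R.+-congˡ (R.+-congˡ (∑ᴷ-↭ p)))
    (solve 3 (λ a b c → a :+ (b :+ c) := b :+ (a :+ c)) R.refl (f x) (f y) (∑ᴷ ys f))
  ∑ᴷ-↭ (↭.trans p p′)  = R.trans (∑ᴷ-↭ p) (∑ᴷ-↭ p′)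

  ∑ᴷ-single : ∀ {xs : List A} {y f} → Unique xs → y ∈ xs → (∀ {x} → x ∈ xs → x ≢ y → f x ≈ᴷ 0#) → ∑ᴷ xs f ≈ᴷ f y
  ∑ᴷ-single {xs = x ∷ xs} (x∉xs ∷ xs!) (here refl) vanish =
    R.trans (R.+-congˡ (∑ᴷ-zero xs (λ z∈ → vanish (there z∈) (λ { refl → All.lookup x∉xs z∈ refl })))) (R.+-identityʳ _)
  ∑ᴷ-single {xs = x ∷ xs} (x∉xs ∷ xs!) (there y∈) vanish =
    R.trans (R.+-cong (vanish (here refl) (All.lookup x∉xs y∈)) (∑ᴷ-single xs! y∈ (vanish ∘ there))) (R.+-identityˡ _)

  ∑ᴷ-upTo-suc : ∀ n {f} → ∑ᴷ (upTo (suc n)) f ≈ᴷ ∑ᴷ (upTo n) f +ᴷ f n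
  ∑ᴷ-upTo-suc n {f} = R.trans (R.reflexive (cong (λ xs → ∑ᴷ xs f) (sym (upTo-∷ʳ n))))
    (R.trans (∑ᴷ-++ (upTo n)) (R.+-congˡ (R.+-identityʳ _)))

  -- The value on `f` of the linear functional that extends `ψ`. It does not see the order or the
  -- repetition of entries in `f`.
  ⟨_,_⟩ᴷ : Lin X → (X → Carrier) → Carrier
  ⟨ f , ψ ⟩ᴷ = ∑ᴷ f (λ (r , x) → r * ψ x)

  pairing-cong : ∀ (f : Lin X) {ψ φ} → (∀ {r x} → (r , x) ∈ f → ψ x ≈ᴷ φ x) → ⟨ f , ψ ⟩ᴷ ≈ᴷ ⟨ f , φ ⟩ᴷ
  pairing-cong f eq = ∑ᴷ-cong f (λ x∈ → R.*-congˡ (eq x∈))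

  pairing-zero : ∀ (f : Lin X) {ψ} → (∀ {r x} → (r , x) ∈ f → ψ x ≈ᴷ 0#) → ⟨ f , ψ ⟩ᴷ ≈ᴷ 0#
  pairing-zero f eq = ∑ᴷ-zero f (λ x∈ → R.trans (R.*-congˡ (eq x∈)) (R.zeroʳ _))

  pairing-⊕ : ∀ (f : Lin X) {g ψ} → ⟨ f ⊕ g , ψ ⟩ᴷ ≈ᴷ ⟨ f , ψ ⟩ᴷ +ᴷ ⟨ g , ψ ⟩ᴷ
  pairing-⊕ f = ∑ᴷ-++ f

  pairing-• : ∀ r (f : Lin X) {ψ} → ⟨ r • f , ψ ⟩ᴷ ≈ᴷ r * ⟨ f , ψ ⟩ᴷ
  pairing-• r f = R.trans (R.reflexive (∑ᴷ-map _ f)) (R.trans (∑ᴷ-cong f (λ _ → R.*-assoc r _ _)) (∑ᴷ-*ˡ f r))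

  pairing-⊖ : ∀ (f : Lin X) {g ψ} → ⟨ f ⊖ g , ψ ⟩ᴷ ≈ᴷ ⟨ f , ψ ⟩ᴷ +ᴷ (-ᴷ 1#) * ⟨ g , ψ ⟩ᴷ
  pairing-⊖ f {g} = R.trans (pairing-⊕ f) (R.+-congˡ (pairing-• _ g))

  pairing-basis : ∀ (x : X) {ψ} → ⟨ basis x , ψ ⟩ᴷ ≈ᴷ ψ x
  pairing-basis x = R.trans (R.+-identityʳ _) (R.*-identityˡ _)

  pairing-linearExtension : ∀ (φ : X → Lin Y) f {ψ} → ⟨ linearExtension φ f , ψ ⟩ᴷ ≈ᴷ ⟨ f , (λ x → ⟨ φ x , ψ ⟩ᴷ) ⟩ᴷ
  pairing-linearExtension φ f = R.trans (∑ᴷ-concatMap _ f) (∑ᴷ-cong f (λ { {r , x} _ → pairing-• r (φ x) }))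

  pairing-bilinearExtension : ∀ (β : X → Y → Lin Z) f g {ψ} →
    ⟨ bilinearExtension β f g , ψ ⟩ᴷ ≈ᴷ ⟨ f , (λ x → ⟨ g , (λ y → ⟨ β x y , ψ ⟩ᴷ) ⟩ᴷ) ⟩ᴷ
  pairing-bilinearExtension β f g = R.trans (pairing-linearExtension _ f) (pairing-cong f (λ {_} {x} _ → pairing-linearExtension (β x) g))

  pairing-∑ : ∀ (ys : List Y) (g : Y → Lin X) {ψ} → ⟨ ∑ ys g , ψ ⟩ᴷ ≈ᴷ ∑ᴷ ys (λ y → ⟨ g y , ψ ⟩ᴷ)
  pairing-∑ ys g = ∑ᴷ-concatMap g ys

  pairing-∑-basis : ∀ (xs : List X) {ψ} → ⟨ ∑ xs basis , ψ ⟩ᴷ ≈ᴷ ∑ᴷ xs ψ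
  pairing-∑-basis xs {ψ} = R.trans (pairing-∑ xs basis) (∑ᴷ-cong xs (λ {x} _ → pairing-basis x {ψ}))

  pairing-∑ᴷ : ∀ (f : Lin X) (ys : List Y) {h : X → Y → Carrier} → ⟨ f , (λ x → ∑ᴷ ys (h x)) ⟩ᴷ ≈ᴷ ∑ᴷ ys (λ y → ⟨ f , (λ x → h x y) ⟩ᴷ)
  pairing-∑ᴷ f ys = R.trans (∑ᴷ-cong f (λ { {r , x} _ → R.sym (∑ᴷ-*ˡ ys r) })) (∑ᴷ-swap f ys)

  pairing-*ˡ : ∀ (f : Lin X) r {ψ} → ⟨ f , (λ x → r * ψ x) ⟩ᴷ ≈ᴷ r * ⟨ f , ψ ⟩ᴷ
  pairing-*ˡ f r {ψ} = R.trans
    (∑ᴷ-cong f (λ { {s , x} _ → solve 3 (λ s r y → s :* (r :* y) := r :* (s :* y)) R.refl s r (ψ x) }))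
    (∑ᴷ-*ˡ f r)

  pairing-+ : ∀ (f : Lin X) {ψ φ} → ⟨ f , (λ x → ψ x +ᴷ φ x) ⟩ᴷ ≈ᴷ ⟨ f , ψ ⟩ᴷ +ᴷ ⟨ f , φ ⟩ᴷ
  pairing-+ f = R.trans (∑ᴷ-cong f (λ _ → R.distribˡ _ _ _)) (∑ᴷ-+ f)

  pairing-swap : ∀ (f : Lin X) (g : Lin Y) {h : X → Y → Carrier} →
    ⟨ f , (λ x → ⟨ g , h x ⟩ᴷ) ⟩ᴷ ≈ᴷ ⟨ g , (λ y → ⟨ f , (λ x → h x y) ⟩ᴷ) ⟩ᴷ
  pairing-swap f g {h} = R.trans (∑ᴷ-cong f (λ { {r , x} _ → R.sym (pairing-*ˡ′ r x) }))
    (R.trans (∑ᴷ-swap f g) (∑ᴷ-cong g (λ { {s , y} _ → ∑ᴷ-*ˡ f s })))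
    where
    pairing-*ˡ′ : ∀ r x → ∑ᴷ g (λ (s , y) → s * (r * h x y)) ≈ᴷ r * ⟨ g , h x ⟩ᴷ
    pairing-*ˡ′ r x = pairing-*ˡ g r

  -- Coefficients as functionals

  𝟙 : {P : Set} → Dec P → Carrier
  𝟙 (yes _) = 1#
  𝟙 (no _)  = 0#

  𝟙-cong : {P Q : Set} (p : Dec P) (q : Dec Q) → (P → Q) → (Q → P) → 𝟙 p ≡ 𝟙 q
  𝟙-cong (yes _) (yes _) _ _ = refl
  𝟙-cong (no _)  (no _)  _ _ = refl
  𝟙-cong (yes p) (no ¬q) f _ = contradiction (f p) ¬q
  𝟙-cong (no ¬p) (yes q) _ g = contradiction (g q) ¬p

  𝟙-no : {P : Set} (p : Dec P) → ¬ P → 𝟙 p ≡ 0#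
  𝟙-no (yes p) ¬p = contradiction p ¬p
  𝟙-no (no _)  _  = refl

  𝟙-yes : {P : Set} (p : Dec P) → P → 𝟙 p ≡ 1#
  𝟙-yes (yes _) _ = refl
  𝟙-yes (no ¬p) p = contradiction p ¬p

  infix 4 _≟ᴸ_

  -- Abstract, so that comparing the heads of two lists by `with` leaves the decision on the lists alone.
  abstract
    _≟ᴸ_ : DecidableEquality (List ℕ)
    _≟ᴸ_ = ≡-dec _≟_

  δ : List ℕ → List ℕ → Carrier
  δ v w = 𝟙 (w ≟ᴸ v)

  -- Stated for any decision procedure, since `δ` uses the abstract `_≟ᴸ_` while the coefficients in
  -- `_≈_` use `≡-dec _≟_`; only the verdicts matter.
  coefficient≈pairing : ∀ (_≟′_ : DecidableEquality (List ℕ)) f w → coefficient _≟′_ f w ≈ᴷ ⟨ f , δ w ⟩ᴷ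
  coefficient≈pairing _≟′_ []            w = R.refl
  coefficient≈pairing _≟′_ ((r , v) ∷ f) w with v ≟′ w
  ... | yes v≡w = R.+-cong (R.trans (R.sym (R.*-identityʳ r)) (R.*-congˡ (R.reflexive (sym (𝟙-yes (v ≟ᴸ w) v≡w))))) (coefficient≈pairing _≟′_ f w)
  ... | no  v≢w = R.trans (coefficient≈pairing _≟′_ f w) (R.trans (R.sym (R.+-identityˡ _))
    (R.+-congʳ (R.trans (R.sym (R.zeroʳ r)) (R.*-congˡ (R.reflexive (sym (𝟙-no (v ≟ᴸ w) v≢w)))))))

  pairing-⊛ : ∀ f g {ψ} → ⟨ f ⊛ g , ψ ⟩ᴷ ≈ᴷ ⟨ f , (λ v → ⟨ g , (λ w → ψ (v ++ w)) ⟩ᴷ) ⟩ᴷ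
  pairing-⊛ f g {ψ} = R.trans (pairing-bilinearExtension (λ v w → basis (v ++ w)) f g)
    (pairing-cong f (λ {_} {v} _ → pairing-cong g (λ {_} {w} _ → pairing-basis (v ++ w) {ψ})))

  -- The power sums are free: modulo words beginning with a smaller letter, Ψₙ₊₁ is (n + 1) Sₙ₊₁.

  powerSum-leading : ∀ n {φ} → (∀ {m} v → m < n → φ (m ∷ v) ≈ᴷ 0#) → ⟨ powerSum (suc n) , φ ⟩ᴷ ≈ᴷ (suc n · 1#) * φ [ n ]
  powerSum-leading n {φ} vanish = begin
    ⟨ powerSum (suc n) , φ ⟩ᴷ
      ≈⟨ pairing-⊖ ((suc n · 1#) • S (suc n)) {foldr _⊕_ [] (zipWith _⊛_ (map (S ∘ suc) (upTo n)) (powerSums n))} {φ} ⟩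
    ⟨ (suc n · 1#) • S (suc n) , φ ⟩ᴷ +ᴷ (-ᴷ 1#) * ⟨ foldr _⊕_ [] (zipWith _⊛_ (map (S ∘ suc) (upTo n)) (powerSums n)) , φ ⟩ᴷ
      ≈⟨ R.+-cong (R.trans (pairing-• (suc n · 1#) (S (suc n)) {φ}) (R.*-congˡ (pairing-basis [ n ] {φ})))
                  (R.trans (R.*-congˡ (lower (upTo n) (powerSums n) (λ m∈ v → vanish v (∈-upTo⁻ m∈)))) (R.zeroʳ _)) ⟩
    (suc n · 1#) * φ [ n ] +ᴷ 0#
      ≈⟨ R.+-identityʳ _ ⟩
    (suc n · 1#) * φ [ n ] ∎
    where
    lower : ∀ ms ps → (∀ {m} → m ∈ ms → ∀ v → φ (m ∷ v) ≈ᴷ 0#) → ⟨ foldr _⊕_ [] (zipWith _⊛_ (map (S ∘ suc) ms) ps) , φ ⟩ᴷ ≈ᴷ 0#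
    lower []       ps       _ = R.refl
    lower (m ∷ ms) []       _ = R.refl
    lower (m ∷ ms) (p ∷ ps) vanish = begin
      ⟨ (S (suc m) ⊛ p) ⊕ foldr _⊕_ [] (zipWith _⊛_ (map (S ∘ suc) ms) ps) , φ ⟩ᴷ
        ≈⟨ pairing-⊕ (S (suc m) ⊛ p) ⟩
      ⟨ S (suc m) ⊛ p , φ ⟩ᴷ +ᴷ ⟨ foldr _⊕_ [] (zipWith _⊛_ (map (S ∘ suc) ms) ps) , φ ⟩ᴷ
        ≈⟨ R.+-cong (R.trans (pairing-⊛ (S (suc m)) p) (R.trans (pairing-basis [ m ] {λ v → ⟨ p , (λ w → φ (v ++ w)) ⟩ᴷ})
             (pairing-zero p (λ {_} {w} _ → vanish (here refl) w)))) (lower ms ps (vanish ∘ there)) ⟩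
      0# +ᴷ 0#
        ≈⟨ R.+-identityˡ 0# ⟩
      0# ∎

  -- Every word of `powerSum (suc n)` begins with a letter at most `n`.
  powerSum-⊛-lower : ∀ n {m} w Y → n < m → ⟨ powerSum (suc n) ⊛ Y , δ (m ∷ w) ⟩ᴷ ≈ᴷ 0#
  powerSum-⊛-lower n {m} w Y n<m = R.trans (pairing-⊛ (powerSum (suc n)) Y) (R.trans
    (powerSum-leading n (λ v m′<n → vanish v (<-trans m′<n n<m)))
    (R.trans (R.*-congˡ (vanish [] n<m)) (R.zeroʳ _)))
    where
    vanish : ∀ {m′} v → m′ < m → ⟨ Y , (λ u → δ (m ∷ w) (m′ ∷ v ++ u)) ⟩ᴷ ≈ᴷ 0#
    vanish v m′<m = pairing-zero Y (λ _ → R.reflexive (𝟙-no (_ ≟ᴸ _) (<⇒≢ m′<m ∘ ∷-injectiveˡ)))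

  powerSum-⊛-top : ∀ n w Y → ⟨ powerSum (suc n) ⊛ Y , δ (n ∷ w) ⟩ᴷ ≈ᴷ (suc n · 1#) * ⟨ Y , δ w ⟩ᴷ
  powerSum-⊛-top n w Y = R.trans (pairing-⊛ (powerSum (suc n)) Y) (R.trans
    (powerSum-leading n (λ v m<n → pairing-zero Y (λ _ → R.reflexive (𝟙-no (_ ≟ᴸ _) (<⇒≢ m<n ∘ ∷-injectiveˡ)))))
    (R.*-congˡ (pairing-cong Y (λ {_} {u} _ → R.reflexive (𝟙-cong (n ∷ u ≟ᴸ n ∷ w) (u ≟ᴸ w) ∷-injectiveʳ (cong (n ∷_)))))))

  δ-∷ : ∀ x v w → δ (x ∷ w) (x ∷ v) ≡ δ w v
  δ-∷ x v w = 𝟙-cong (x ∷ v ≟ᴸ x ∷ w) (v ≟ᴸ w) ∷-injectiveʳ (cong (x ∷_))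

  -- A coefficient functional precomposed with left concatenation by `v` is zero or again a
  -- coefficient functional. So `⊛-zeroʳ` needs to know only that coefficients vanish.
  δ-strip : ∀ v w → (∀ u → δ w (v ++ u) ≡ 0#) ⊎ (∃ λ w′ → ∀ u → δ w (v ++ u) ≡ δ w′ u)
  δ-strip []      w       = inj₂ (w , λ _ → refl)
  δ-strip (x ∷ v) []      = inj₁ λ u → 𝟙-no (x ∷ v ++ u ≟ᴸ []) λ ()
  δ-strip (x ∷ v) (y ∷ w) with x ≟ y
  ... | no x≢y = inj₁ λ u → 𝟙-no (x ∷ v ++ u ≟ᴸ y ∷ w) (x≢y ∘ ∷-injectiveˡ)
  ... | yes refl with δ-strip v w
  ...   | inj₁ vanish      = inj₁ λ u → trans (δ-∷ x (v ++ u) w) (vanish u)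
  ...   | inj₂ (w′ , same) = inj₂ (w′ , λ u → trans (δ-∷ x (v ++ u) w) (same u))

  IsZero : Sym → Set ℓ
  IsZero f = ∀ w → ⟨ f , δ w ⟩ᴷ ≈ᴷ 0#

  ⊛-zeroʳ : ∀ f {g} → IsZero g → IsZero (f ⊛ g)
  ⊛-zeroʳ f {g} g≈0 w = R.trans (pairing-⊛ f g) (pairing-zero f (λ {_} {v} _ → inner v))
    where
    inner : ∀ v → ⟨ g , (λ u → δ w (v ++ u)) ⟩ᴷ ≈ᴷ 0#
    inner v with δ-strip v w
    ... | inj₁ vanish      = pairing-zero g (λ {_} {u} _ → R.reflexive (vanish u))
    ... | inj₂ (w′ , same) = R.trans (pairing-cong g (λ {_} {u} _ → R.reflexive (same u))) (g≈0 w′)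

  -- The ring need not be a domain; positive integers cancel because they are invertible.
  ·-cancel : ∀ n {x} → (suc n · 1#) * x ≈ᴷ 0# → x ≈ᴷ 0#
  ·-cancel n {x} eq = begin
    x                                    ≈⟨ R.*-identityˡ x ⟨
    1# * x                               ≈⟨ R.*-congʳ (R.1/-inv (suc n)) ⟨
    ((suc n · 1#) * (1/ suc n)) * x      ≈⟨ solve 3 (λ a b x → (a :* b) :* x := b :* (a :* x)) R.refl (suc n · 1#) (1/ suc n) x ⟩
    (1/ suc n) * ((suc n · 1#) * x)      ≈⟨ R.*-congˡ eq ⟩
    (1/ suc n) * 0#                      ≈⟨ R.zeroʳ _ ⟩
    0#                                   ∎

  powerSums-free : ∀ N (X : ℕ → Sym) → (∀ w → ∑ᴷ (upTo N) (λ n → ⟨ powerSum (suc n) ⊛ X n , δ w ⟩ᴷ) ≈ᴷ 0#) → ∀ n → n < N → IsZero (X n)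
  powerSums-free (suc N) X eq n n<sN = case-top (m≤n⇒m<n∨m≡n (s≤s⁻¹ n<sN))
    where
    top : IsZero (X N)
    top w = ·-cancel N (begin
      (suc N · 1#) * ⟨ X N , δ w ⟩ᴷ                    ≈⟨ powerSum-⊛-top N w (X N) ⟨
      ⟨ powerSum (suc N) ⊛ X N , δ (N ∷ w) ⟩ᴷ          ≈⟨ R.+-identityˡ _ ⟨
      0# +ᴷ ⟨ powerSum (suc N) ⊛ X N , δ (N ∷ w) ⟩ᴷ    ≈⟨ R.+-congʳ (∑ᴷ-zero (upTo N) (λ {n} n∈ → powerSum-⊛-lower n w (X n) (∈-upTo⁻ n∈))) ⟨
      ∑ᴷ (upTo N) (λ n → ⟨ powerSum (suc n) ⊛ X n , δ (N ∷ w) ⟩ᴷ) +ᴷ ⟨ powerSum (suc N) ⊛ X N , δ (N ∷ w) ⟩ᴷ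
                                                       ≈⟨ ∑ᴷ-upTo-suc N ⟨
      ∑ᴷ (upTo (suc N)) (λ n → ⟨ powerSum (suc n) ⊛ X n , δ (N ∷ w) ⟩ᴷ) ≈⟨ eq (N ∷ w) ⟩
      0# ∎)

    rest : ∀ w → ∑ᴷ (upTo N) (λ n → ⟨ powerSum (suc n) ⊛ X n , δ w ⟩ᴷ) ≈ᴷ 0#
    rest w = begin
      ∑ᴷ (upTo N) (λ n → ⟨ powerSum (suc n) ⊛ X n , δ w ⟩ᴷ)       ≈⟨ R.+-identityʳ _ ⟨
      ∑ᴷ (upTo N) (λ n → ⟨ powerSum (suc n) ⊛ X n , δ w ⟩ᴷ) +ᴷ 0# ≈⟨ R.+-congˡ (⊛-zeroʳ (powerSum (suc N)) {X N} top w) ⟨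
      ∑ᴷ (upTo N) (λ n → ⟨ powerSum (suc n) ⊛ X n , δ w ⟩ᴷ) +ᴷ ⟨ powerSum (suc N) ⊛ X N , δ w ⟩ᴷ ≈⟨ ∑ᴷ-upTo-suc N ⟨
      ∑ᴷ (upTo (suc N)) (λ n → ⟨ powerSum (suc n) ⊛ X n , δ w ⟩ᴷ) ≈⟨ eq w ⟩
      0# ∎

    case-top : n < N ⊎ n ≡ N → IsZero (X n)
    case-top (inj₁ n<N)  = powerSums-free N X rest n n<N
    case-top (inj₂ refl) = top

  -- Linear independence of the monomial functions

  Supported : (X → Set) → Lin X → Set c
  Supported P = All (P ∘ proj₂)

  supported-• : ∀ {P : X → Set} r f → Supported P f → Supported P (r • f)
  supported-• r f = All.map⁺

  supported-linearExtension : ∀ {P : X → Set} {Q : Y → Set} (φ : X → Lin Y) {f} →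
    (∀ x → P x → Supported Q (φ x)) → Supported P f → Supported Q (linearExtension φ f)
  supported-linearExtension φ h []       = []
  supported-linearExtension φ {(r , x) ∷ f} h (p ∷ ps) = All.++⁺ (supported-• r (φ x) (h x p)) (supported-linearExtension φ h ps)

  Ψ̂ : Lin (List ℕ) → Sym
  Ψ̂ = linearExtension Ψ

  atEqual : ℕ → ℕ → List ℕ → Lin (List ℕ)
  atEqual a b I with b ≟ a
  ... | yes _ = basis I
  ... | no  _ = []

  -- tevlinSum b I = ∑ₐ powerSum a ⊛ Ψ̂ (tevlinPart a b I)
  tevlinPart : ℕ → ℕ → List ℕ → Lin (List ℕ)
  tevlinPart a b []      = atEqual a b []
  tevlinPart a b (i ∷ I) = atEqual a b (i ∷ I) ⊖ tevlinPart a (b + i) I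

  -- The right factor of the power sum of index `a` when Ψ_I is expanded by its leftmost power sum.
  ΨPart : ℕ → List ℕ → Lin (List ℕ)
  ΨPart a []      = []
  ΨPart a (i ∷ I) = (1/ suc (length I)) • tevlinPart a i I

  pairing-atEqual : ∀ a b I {ψ} → ⟨ atEqual a b I , ψ ⟩ᴷ ≈ᴷ 𝟙 (b ≟ a) * ψ I
  pairing-atEqual a b I {ψ} with b ≟ a
  ... | yes _ = R.trans (pairing-basis I {ψ}) (R.sym (R.*-identityˡ _))
  ... | no  _ = R.sym (R.zeroˡ _)

  module _ (ψ : List ℕ → Carrier) where

    private
      κ : ℕ → List ℕ → Carrier
      κ a I = ⟨ powerSum a ⊛ Ψ I , ψ ⟩ᴷ

    atEqual-sum : ∀ N b I → 0 < b → b ≤ N → ∑ᴷ (upTo N) (λ n → ⟨ atEqual (suc n) b I , κ (suc n) ⟩ᴷ) ≈ᴷ κ b I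
    atEqual-sum N (suc b) I _ b≤N = R.trans
      (∑ᴷ-single (Unique.upTo⁺ N) (∈-upTo⁺ b≤N) (λ {n} _ n≢b → R.trans (pairing-atEqual (suc n) (suc b) I)
        (R.trans (R.*-congʳ (R.reflexive (𝟙-no (suc b ≟ suc n) (n≢b ∘ sym ∘ suc-injective)))) (R.zeroˡ _))))
      (R.trans (pairing-atEqual (suc b) (suc b) I) (R.trans (R.*-congʳ (R.reflexive (𝟙-yes (suc b ≟ suc b) refl))) (R.*-identityˡ _)))

    tevlinSum-decomposition : ∀ N b I → 0 < b → b + sum I ≤ N →
      ⟨ tevlinSum b I , ψ ⟩ᴷ ≈ᴷ ∑ᴷ (upTo N) (λ n → ⟨ tevlinPart (suc n) b I , κ (suc n) ⟩ᴷ)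
    tevlinSum-decomposition N b [] 0<b ≤N = begin
      ⟨ powerSum b , ψ ⟩ᴷ
        ≈⟨ pairing-cong (powerSum b) (λ {_} {v} _ → R.trans (pairing-basis [] {λ w → ψ (v ++ w)}) (R.reflexive (cong ψ (++-identityʳ v)))) ⟨
      ⟨ powerSum b , (λ v → ⟨ S 0 , (λ w → ψ (v ++ w)) ⟩ᴷ) ⟩ᴷ
        ≈⟨ pairing-⊛ (powerSum b) (S 0) ⟨
      κ b []
        ≈⟨ atEqual-sum N b [] 0<b (≤-trans (m≤m+n b 0) ≤N) ⟨
      ∑ᴷ (upTo N) (λ n → ⟨ atEqual (suc n) b [] , κ (suc n) ⟩ᴷ) ∎
    tevlinSum-decomposition N b (i ∷ I) 0<b ≤N = begin
      ⟨ powerSum b ⊛ Ψ (i ∷ I) ⊖ tevlinSum (b + i) I , ψ ⟩ᴷ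
        ≈⟨ pairing-⊖ (powerSum b ⊛ Ψ (i ∷ I)) ⟩
      κ b (i ∷ I) +ᴷ (-ᴷ 1#) * ⟨ tevlinSum (b + i) I , ψ ⟩ᴷ
        ≈⟨ R.+-cong (R.sym (atEqual-sum N b (i ∷ I) 0<b (≤-trans (m≤m+n b _) ≤N)))
             (R.*-congˡ (tevlinSum-decomposition N (b + i) I (≤-trans 0<b (m≤m+n b i)) (≤-trans (≤-reflexive (+-assoc b i (sum I))) ≤N))) ⟩
      ∑ᴷ (upTo N) (λ n → ⟨ atEqual (suc n) b (i ∷ I) , κ (suc n) ⟩ᴷ) +ᴷ (-ᴷ 1#) * ∑ᴷ (upTo N) (λ n → ⟨ tevlinPart (suc n) (b + i) I , κ (suc n) ⟩ᴷ)
        ≈⟨ R.+-congˡ (R.sym (∑ᴷ-*ˡ (upTo N) (-ᴷ 1#))) ⟩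
      ∑ᴷ (upTo N) (λ n → ⟨ atEqual (suc n) b (i ∷ I) , κ (suc n) ⟩ᴷ) +ᴷ ∑ᴷ (upTo N) (λ n → (-ᴷ 1#) * ⟨ tevlinPart (suc n) (b + i) I , κ (suc n) ⟩ᴷ)
        ≈⟨ R.sym (∑ᴷ-+ (upTo N)) ⟩
      ∑ᴷ (upTo N) (λ n → ⟨ atEqual (suc n) b (i ∷ I) , κ (suc n) ⟩ᴷ +ᴷ (-ᴷ 1#) * ⟨ tevlinPart (suc n) (b + i) I , κ (suc n) ⟩ᴷ)
        ≈⟨ ∑ᴷ-cong (upTo N) (λ {n} _ → R.sym (pairing-⊖ (atEqual (suc n) b (i ∷ I)))) ⟩
      ∑ᴷ (upTo N) (λ n → ⟨ tevlinPart (suc n) b (i ∷ I) , κ (suc n) ⟩ᴷ) ∎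

    Ψ-decomposition : ∀ N i I → (i ∷ I) ⊨ N → ⟨ Ψ (i ∷ I) , ψ ⟩ᴷ ≈ᴷ ∑ᴷ (upTo N) (λ n → ⟨ ΨPart (suc n) (i ∷ I) , κ (suc n) ⟩ᴷ)
    Ψ-decomposition N i I (0<i ∷ _ , sum≡) = begin
      ⟨ (1/ suc (length I)) • tevlinSum i I , ψ ⟩ᴷ
        ≈⟨ pairing-• (1/ suc (length I)) (tevlinSum i I) ⟩
      (1/ suc (length I)) * ⟨ tevlinSum i I , ψ ⟩ᴷ
        ≈⟨ R.*-congˡ (tevlinSum-decomposition N i I 0<i (≤-reflexive sum≡)) ⟩
      (1/ suc (length I)) * ∑ᴷ (upTo N) (λ n → ⟨ tevlinPart (suc n) i I , κ (suc n) ⟩ᴷ)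
        ≈⟨ R.sym (∑ᴷ-*ˡ (upTo N) (1/ suc (length I))) ⟩
      ∑ᴷ (upTo N) (λ n → (1/ suc (length I)) * ⟨ tevlinPart (suc n) i I , κ (suc n) ⟩ᴷ)
        ≈⟨ ∑ᴷ-cong (upTo N) (λ {n} _ → R.sym (pairing-• (1/ suc (length I)) (tevlinPart (suc n) i I))) ⟩
      ∑ᴷ (upTo N) (λ n → ⟨ ΨPart (suc n) (i ∷ I) , κ (suc n) ⟩ᴷ) ∎

    pairing-⊛-Ψ̂ : ∀ a f → ⟨ powerSum a ⊛ Ψ̂ f , ψ ⟩ᴷ ≈ᴷ ⟨ f , κ a ⟩ᴷ
    pairing-⊛-Ψ̂ a f = begin
      ⟨ powerSum a ⊛ Ψ̂ f , ψ ⟩ᴷ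
        ≈⟨ pairing-⊛ (powerSum a) (Ψ̂ f) ⟩
      ⟨ powerSum a , (λ v → ⟨ Ψ̂ f , (λ w → ψ (v ++ w)) ⟩ᴷ) ⟩ᴷ
        ≈⟨ pairing-cong (powerSum a) (λ _ → pairing-linearExtension Ψ f) ⟩
      ⟨ powerSum a , (λ v → ⟨ f , (λ I → ⟨ Ψ I , (λ w → ψ (v ++ w)) ⟩ᴷ) ⟩ᴷ) ⟩ᴷ
        ≈⟨ pairing-swap (powerSum a) f ⟩
      ⟨ f , (λ I → ⟨ powerSum a , (λ v → ⟨ Ψ I , (λ w → ψ (v ++ w)) ⟩ᴷ) ⟩ᴷ) ⟩ᴷ
        ≈⟨ pairing-cong f (λ {_} {I} _ → R.sym (pairing-⊛ (powerSum a) (Ψ I))) ⟩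
      ⟨ f , κ a ⟩ᴷ ∎

    Ψ̂-decomposition : ∀ N f → Supported (_⊨ suc N) f →
      ⟨ Ψ̂ f , ψ ⟩ᴷ ≈ᴷ ∑ᴷ (upTo (suc N)) (λ n → ⟨ powerSum (suc n) ⊛ Ψ̂ (linearExtension (ΨPart (suc n)) f) , ψ ⟩ᴷ)
    Ψ̂-decomposition N f f-supported = begin
      ⟨ Ψ̂ f , ψ ⟩ᴷ
        ≈⟨ pairing-linearExtension Ψ f ⟩
      ⟨ f , (λ I → ⟨ Ψ I , ψ ⟩ᴷ) ⟩ᴷ
        ≈⟨ pairing-cong f (λ x∈ → pointwise _ (All.lookup f-supported x∈)) ⟩
      ⟨ f , (λ I → ∑ᴷ (upTo (suc N)) (λ n → ⟨ ΨPart (suc n) I , κ (suc n) ⟩ᴷ)) ⟩ᴷ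
        ≈⟨ pairing-∑ᴷ f (upTo (suc N)) ⟩
      ∑ᴷ (upTo (suc N)) (λ n → ⟨ f , (λ I → ⟨ ΨPart (suc n) I , κ (suc n) ⟩ᴷ) ⟩ᴷ)
        ≈⟨ ∑ᴷ-cong (upTo (suc N)) (λ {n} _ → R.trans (R.sym (pairing-linearExtension (ΨPart (suc n)) f)) (R.sym (pairing-⊛-Ψ̂ (suc n) (linearExtension (ΨPart (suc n)) f)))) ⟩
      ∑ᴷ (upTo (suc N)) (λ n → ⟨ powerSum (suc n) ⊛ Ψ̂ (linearExtension (ΨPart (suc n)) f) , ψ ⟩ᴷ) ∎
      where
      pointwise : ∀ I → I ⊨ suc N → ⟨ Ψ I , ψ ⟩ᴷ ≈ᴷ ∑ᴷ (upTo (suc N)) (λ n → ⟨ ΨPart (suc n) I , κ (suc n) ⟩ᴷ)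
      pointwise (i ∷ I) I⊨ = Ψ-decomposition (suc N) i I I⊨

  atEqual-supported : ∀ a b {I} → All (0 <_) I → Supported (λ L → All (0 <_) L × a + sum L ≡ b + sum I) (atEqual a b I)
  atEqual-supported a b ps with b ≟ a
  ... | yes refl = (ps , refl) ∷ []
  ... | no  _    = []

  tevlinPart-supported : ∀ a b {I} → All (0 <_) I → Supported (λ L → All (0 <_) L × a + sum L ≡ b + sum I) (tevlinPart a b I)
  tevlinPart-supported a b {[]}    ps       = atEqual-supported a b ps
  tevlinPart-supported a b {i ∷ I} (p ∷ ps) = All.++⁺ (atEqual-supported a b (p ∷ ps))
    (supported-• _ (tevlinPart a (b + i) I) (All.map (λ (qs , eq) → qs , trans eq (+-assoc b i (sum I))) (tevlinPart-supported a (b + i) ps)))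

  ΨPart-supported : ∀ a n I → I ⊨ n → Supported (_⊨ (n ∸ a)) (ΨPart a I)
  ΨPart-supported a n []      _ = []
  ΨPart-supported a n (i ∷ I) (p ∷ ps , eq) = supported-• _ (tevlinPart a i I)
    (All.map (λ {(_ , L)} (qs , eq′) → qs , trans (sym (m+n∸m≡n a (sum L))) (cong (_∸ a) (trans eq′ eq))) (tevlinPart-supported a i ps))

  tevlinCoefficient : ℕ → List ℕ → ℕ → List ℕ → Carrier
  tevlinCoefficient a L b I = ⟨ tevlinPart a b I , δ L ⟩ᴷ

  atEqual-coefficient : ∀ a L b I → ⟨ atEqual a b I , δ L ⟩ᴷ ≈ᴷ δ (a ∷ L) (b ∷ I)
  atEqual-coefficient a L b I with b ≟ a
  ... | yes refl = R.trans (pairing-basis I {δ L}) (R.reflexive (𝟙-cong (I ≟ᴸ L) (b ∷ I ≟ᴸ b ∷ L) (cong (b ∷_)) ∷-injectiveʳ))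
  ... | no  b≢a  = R.reflexive (sym (𝟙-no (b ∷ I ≟ᴸ a ∷ L) (b≢a ∘ ∷-injectiveˡ)))

  tevlinCoefficient-∷ : ∀ a L b i I → tevlinCoefficient a L b (i ∷ I) ≈ᴷ δ (a ∷ L) (b ∷ i ∷ I) +ᴷ (-ᴷ 1#) * tevlinCoefficient a L (b + i) I
  tevlinCoefficient-∷ a L b i I = R.trans (pairing-⊖ (atEqual a b (i ∷ I))) (R.+-congʳ (atEqual-coefficient a L b (i ∷ I)))

  -- Among the ways to cut `a` into two positive parts, only the one with `suc h = i` can match
  -- `b ∷ i ∷ I`.
  δ-split : ∀ a L b i I → 0 < b → 0 < i →
    δ (a ∷ L) (b + i ∷ I) ≈ᴷ ∑ᴷ (upTo (a ∸ 1)) (λ h → δ (a ∸ suc h ∷ suc h ∷ L) (b ∷ i ∷ I))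
  δ-split a L b (suc h₀) I 0<b _ with b + suc h₀ ∷ I ≟ᴸ a ∷ L
  ... | yes refl = R.sym (R.trans
    (∑ᴷ-single (Unique.upTo⁺ _) (∈-upTo⁺ h₀<) (λ {h} _ h≢h₀ → R.reflexive (𝟙-no (_ ≟ᴸ _) (λ eq → h≢h₀ (sym (suc-injective (∷-injectiveˡ (∷-injectiveʳ eq))))))))
    (R.reflexive (𝟙-yes (_ ≟ᴸ _) (cong (_∷ suc h₀ ∷ L) (sym (m+n∸n≡m b (suc h₀)))))))
    where
    h₀< : h₀ < b + suc h₀ ∸ 1
    h₀< rewrite +-suc b h₀ = m<n+m h₀ 0<b
  ... | no  ≢    = R.sym (∑ᴷ-zero (upTo (a ∸ 1)) (λ {h} h∈ → R.reflexive (𝟙-no (_ ≟ᴸ _) (λ eq → ≢ (merge h (∈-upTo⁻ h∈) eq)))))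
    where
    merge : ∀ h → h < a ∸ 1 → b ∷ suc h₀ ∷ I ≡ a ∸ suc h ∷ suc h ∷ L → b + suc h₀ ∷ I ≡ a ∷ L
    merge h h< refl = cong (_∷ I) (m∸n+n≡m (≤-trans h< (m∸n≤m a 1)))

  -- Expanding by `tevlinCoefficient-∷`, the leading terms agree by `δ-split`, and what is left is
  -- the same identity with `b + i` in place of `b`.
  tevlinCoefficient-split : ∀ a L b i I → 0 < b → All (0 <_) (i ∷ I) →
    tevlinCoefficient a L (b + i) I ≈ᴷ ∑ᴷ (upTo (a ∸ 1)) (λ h → tevlinCoefficient (a ∸ suc h) (suc h ∷ L) b (i ∷ I))
  tevlinCoefficient-split a L b i I 0<b (0<i ∷ ps) = R.sym (begin
    ∑ᴷ H (λ h → tevlinCoefficient (a ∸ suc h) (suc h ∷ L) b (i ∷ I))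
      ≈⟨ ∑ᴷ-cong H (λ {h} _ → tevlinCoefficient-∷ (a ∸ suc h) (suc h ∷ L) b i I) ⟩
    ∑ᴷ H (λ h → δ (a ∸ suc h ∷ suc h ∷ L) (b ∷ i ∷ I) +ᴷ (-ᴷ 1#) * tevlinCoefficient (a ∸ suc h) (suc h ∷ L) (b + i) I)
      ≈⟨ ∑ᴷ-+ H ⟩
    ∑ᴷ H (λ h → δ (a ∸ suc h ∷ suc h ∷ L) (b ∷ i ∷ I)) +ᴷ ∑ᴷ H (λ h → (-ᴷ 1#) * tevlinCoefficient (a ∸ suc h) (suc h ∷ L) (b + i) I)
      ≈⟨ R.+-cong (R.sym (δ-split a L b i I 0<b 0<i)) (∑ᴷ-*ˡ H (-ᴷ 1#)) ⟩
    δ (a ∷ L) (b + i ∷ I) +ᴷ (-ᴷ 1#) * ∑ᴷ H (λ h → tevlinCoefficient (a ∸ suc h) (suc h ∷ L) (b + i) I)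
      ≈⟨ remainder I ps ⟩
    tevlinCoefficient a L (b + i) I ∎)
    where
    H = upTo (a ∸ 1)

    remainder : ∀ I → All (0 <_) I →
      δ (a ∷ L) (b + i ∷ I) +ᴷ (-ᴷ 1#) * ∑ᴷ H (λ h → tevlinCoefficient (a ∸ suc h) (suc h ∷ L) (b + i) I) ≈ᴷ tevlinCoefficient a L (b + i) I
    remainder [] _ = begin
      δ (a ∷ L) (b + i ∷ []) +ᴷ (-ᴷ 1#) * ∑ᴷ H (λ h → tevlinCoefficient (a ∸ suc h) (suc h ∷ L) (b + i) [])
        ≈⟨ R.+-congˡ (R.trans (R.*-congˡ (∑ᴷ-zero H (λ {h} _ → R.trans (atEqual-coefficient (a ∸ suc h) (suc h ∷ L) (b + i) [])
             (R.reflexive (𝟙-no (b + i ∷ [] ≟ᴸ a ∸ suc h ∷ suc h ∷ L) (λ ())))))) (R.zeroʳ _)) ⟩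
      δ (a ∷ L) (b + i ∷ []) +ᴷ 0#
        ≈⟨ R.+-identityʳ _ ⟩
      δ (a ∷ L) (b + i ∷ [])
        ≈⟨ R.sym (atEqual-coefficient a L (b + i) []) ⟩
      tevlinCoefficient a L (b + i) [] ∎
    remainder (i₂ ∷ I) ps = R.trans
      (R.+-congˡ (R.*-congˡ (R.sym (tevlinCoefficient-split a L (b + i) i₂ I (≤-trans 0<b (m≤m+n b i)) ps))))
      (R.sym (tevlinCoefficient-∷ a L (b + i) i₂ I))

  minus-cancel : ∀ x → (-ᴷ 1#) * x +ᴷ x ≈ᴷ 0#
  minus-cancel x = begin
    (-ᴷ 1#) * x +ᴷ x        ≈⟨ R.+-congˡ (R.*-identityˡ x) ⟨
    (-ᴷ 1#) * x +ᴷ 1# * x   ≈⟨ R.distribʳ x (-ᴷ 1#) 1# ⟨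
    ((-ᴷ 1#) +ᴷ 1#) * x     ≈⟨ R.*-congʳ (R.-‿inverseˡ 1#) ⟩
    0# * x                  ≈⟨ R.zeroˡ x ⟩
    0#                      ∎

  -- Merging the first two parts of b ∷ i ∷ I cancels the alternating terms in pairs.
  δ-tevlinCoefficient : ∀ a L b I → 0 < b → All (0 <_) I →
    tevlinCoefficient a L b I +ᴷ ∑ᴷ (upTo (a ∸ 1)) (λ h → tevlinCoefficient (a ∸ suc h) (suc h ∷ L) b I) ≈ᴷ δ (a ∷ L) (b ∷ I)
  δ-tevlinCoefficient a L b [] 0<b _ = R.trans
    (R.+-cong (atEqual-coefficient a L b []) (∑ᴷ-zero (upTo (a ∸ 1)) (λ {h} _ → R.trans (atEqual-coefficient (a ∸ suc h) (suc h ∷ L) b [])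
      (R.reflexive (𝟙-no (b ∷ [] ≟ᴸ a ∸ suc h ∷ suc h ∷ L) (λ ()))))))
    (R.+-identityʳ _)
  δ-tevlinCoefficient a L b (i ∷ I) 0<b ps = begin
    tevlinCoefficient a L b (i ∷ I) +ᴷ ∑ᴷ (upTo (a ∸ 1)) (λ h → tevlinCoefficient (a ∸ suc h) (suc h ∷ L) b (i ∷ I))
      ≈⟨ R.+-cong (tevlinCoefficient-∷ a L b i I) (R.sym (tevlinCoefficient-split a L b i I 0<b ps)) ⟩
    δ (a ∷ L) (b ∷ i ∷ I) +ᴷ (-ᴷ 1#) * t +ᴷ t
      ≈⟨ R.trans (R.+-assoc _ _ _) (R.+-congˡ (minus-cancel t)) ⟩
    δ (a ∷ L) (b ∷ i ∷ I) +ᴷ 0#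
      ≈⟨ R.+-identityʳ _ ⟩
    δ (a ∷ L) (b ∷ i ∷ I) ∎
    where t = tevlinCoefficient a L (b + i) I

  -- The dual form of a product rule. With ℓ the length of L, the definition of Ψ gives Ψ_a Ψ_L = (ℓ
  -- + 1) Ψ_{(a, L)} plus, for nonempty L, ℓ times the function with a merged into the first part of
  -- L. So Ψ_{(a, L)} comes with the same factor ℓ + 1 from Ψ_a Ψ_L and from each Ψ_{a - h} Ψ_{(h,
  -- L)} with 0 < h < a.
  δ-ΨPart : ∀ a L I → All (0 <_) I →
    ⟨ ΨPart a I , δ L ⟩ᴷ +ᴷ ∑ᴷ (upTo (a ∸ 1)) (λ h → ⟨ ΨPart (a ∸ suc h) I , δ (suc h ∷ L) ⟩ᴷ) ≈ᴷ (1/ suc (length L)) * δ (a ∷ L) I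
  δ-ΨPart a L [] _ = R.trans (R.+-identityˡ _) (R.trans (∑ᴷ-zero (upTo (a ∸ 1)) (λ _ → R.refl))
    (R.sym (R.trans (R.*-congˡ (R.reflexive (𝟙-no ([] ≟ᴸ a ∷ L) (λ ())))) (R.zeroʳ _))))
  δ-ΨPart a L (i ∷ I) (0<i ∷ ps) = begin
    ⟨ ΨPart a (i ∷ I) , δ L ⟩ᴷ +ᴷ ∑ᴷ H (λ h → ⟨ ΨPart (a ∸ suc h) (i ∷ I) , δ (suc h ∷ L) ⟩ᴷ)
      ≈⟨ R.+-cong (pairing-• r (tevlinPart a i I)) (R.trans (∑ᴷ-cong H (λ {h} _ → pairing-• r (tevlinPart (a ∸ suc h) i I))) (∑ᴷ-*ˡ H r)) ⟩
    r * tevlinCoefficient a L i I +ᴷ r * ∑ᴷ H (λ h → tevlinCoefficient (a ∸ suc h) (suc h ∷ L) i I)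
      ≈⟨ R.distribˡ r _ _ ⟨
    r * (tevlinCoefficient a L i I +ᴷ ∑ᴷ H (λ h → tevlinCoefficient (a ∸ suc h) (suc h ∷ L) i I))
      ≈⟨ R.*-congˡ (δ-tevlinCoefficient a L i I 0<i ps) ⟩
    r * δ (a ∷ L) (i ∷ I)
      ≈⟨ same-length ⟩
    (1/ suc (length L)) * δ (a ∷ L) (i ∷ I) ∎
    where
    H = upTo (a ∸ 1)
    r = 1/ suc (length I)
    same-length : r * δ (a ∷ L) (i ∷ I) ≈ᴷ (1/ suc (length L)) * δ (a ∷ L) (i ∷ I)
    same-length with i ∷ I ≟ᴸ a ∷ L
    ... | yes refl = R.refl
    ... | no  _    = R.trans (R.zeroʳ _) (R.sym (R.zeroʳ _))

  inverse-cancel : ∀ n {x} → (1/ suc n) * x ≈ᴷ 0# → x ≈ᴷ 0#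
  inverse-cancel n {x} eq = begin
    x                                    ≈⟨ R.*-identityˡ x ⟨
    1# * x                               ≈⟨ R.*-congʳ (R.1/-inv (suc n)) ⟨
    ((suc n · 1#) * (1/ suc n)) * x      ≈⟨ R.*-assoc _ _ _ ⟩
    (suc n · 1#) * ((1/ suc n) * x)      ≈⟨ R.*-congˡ eq ⟩
    (suc n · 1#) * 0#                    ≈⟨ R.zeroʳ _ ⟩
    0#                                   ∎

  -- Freeness of the power sums makes `Ψ̂` vanish on the part of `f` behind each power sum. The
  -- parts have smaller degree, so by induction their coefficients vanish, and `δ-ΨPart` rebuilds
  -- those of `f`. The bound `N` drives the recursion, as the degree may drop by more than one.
  Ψ-independent : ∀ N n f → n ≤ N → Supported (_⊨ n) f → IsZero (Ψ̂ f) → ∀ I → I ⊨ n → ⟨ f , δ I ⟩ᴷ ≈ᴷ 0#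
  -- In degree 0 only Ψ_() = 1 occurs, and its coefficient is that of the empty word.
  Ψ-independent N zero f _ f-supported f≈0 [] _ = begin
    ⟨ f , δ [] ⟩ᴷ                          ≈⟨ pairing-cong f (λ x∈ → pointwise _ (All.lookup f-supported x∈)) ⟩
    ⟨ f , (λ I → ⟨ Ψ I , δ [] ⟩ᴷ) ⟩ᴷ       ≈⟨ pairing-linearExtension Ψ f ⟨
    ⟨ Ψ̂ f , δ [] ⟩ᴷ                        ≈⟨ f≈0 [] ⟩
    0#                                     ∎
    where
    pointwise : ∀ I → I ⊨ 0 → δ [] I ≈ᴷ ⟨ Ψ I , δ [] ⟩ᴷ
    pointwise []          _            = R.sym (pairing-basis [] {δ []})
    pointwise (zero ∷ I)  (() ∷ _ , _)
    pointwise (suc i ∷ I) (_ , ())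
  Ψ-independent N zero f _ _ _ (zero ∷ I)  (() ∷ _ , _)
  Ψ-independent N zero f _ _ _ (suc i ∷ I) (_ , ())
  Ψ-independent (suc N) (suc n) f (s≤s n≤N) f-supported f≈0 (a ∷ L) (0<a ∷ L+ , sum≡) = inverse-cancel (length L) (begin
    (1/ suc (length L)) * ⟨ f , δ (a ∷ L) ⟩ᴷ
      ≈⟨ pairing-*ˡ f (1/ suc (length L)) ⟨
    ⟨ f , (λ I → (1/ suc (length L)) * δ (a ∷ L) I) ⟩ᴷ
      ≈⟨ pairing-cong f (λ {_} {I} x∈ → R.sym (δ-ΨPart a L I (proj₁ (All.lookup f-supported x∈)))) ⟩
    ⟨ f , (λ I → ⟨ ΨPart a I , δ L ⟩ᴷ +ᴷ ∑ᴷ H (λ h → ⟨ ΨPart (a ∸ suc h) I , δ (suc h ∷ L) ⟩ᴷ)) ⟩ᴷ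
      ≈⟨ pairing-+ f ⟩
    ⟨ f , (λ I → ⟨ ΨPart a I , δ L ⟩ᴷ) ⟩ᴷ +ᴷ ⟨ f , (λ I → ∑ᴷ H (λ h → ⟨ ΨPart (a ∸ suc h) I , δ (suc h ∷ L) ⟩ᴷ)) ⟩ᴷ
      ≈⟨ R.+-congˡ (pairing-∑ᴷ f H) ⟩
    ⟨ f , (λ I → ⟨ ΨPart a I , δ L ⟩ᴷ) ⟩ᴷ +ᴷ ∑ᴷ H (λ h → ⟨ f , (λ I → ⟨ ΨPart (a ∸ suc h) I , δ (suc h ∷ L) ⟩ᴷ) ⟩ᴷ)
      ≈⟨ R.+-cong (part-zero a L 0<a L+ sum≡) (∑ᴷ-zero H (λ {h} h∈ → part-zero (a ∸ suc h) (suc h ∷ L)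
           (positive h (∈-upTo⁻ h∈)) (z<s ∷ L+) (trans (sym (+-assoc (a ∸ suc h) (suc h) (sum L))) (trans (cong (_+ sum L) (m∸n+n≡m (≤-trans (∈-upTo⁻ h∈) (m∸n≤m a 1)))) sum≡)))) ⟩
    0# +ᴷ 0#
      ≈⟨ R.+-identityˡ 0# ⟩
    0# ∎)
    where
    H = upTo (a ∸ 1)

    positive : ∀ h → h < a ∸ 1 → 0 < a ∸ suc h
    positive h h< = m<n⇒0<n∸m (≤-trans (s<s h<) (≤-reflexive (m+[n∸m]≡n 0<a)))

    part : ℕ → Lin (List ℕ)
    part k = linearExtension (ΨPart (suc k)) f

    part-zero : ∀ a′ L′ → 0 < a′ → All (0 <_) L′ → a′ + sum L′ ≡ suc n → ⟨ f , (λ I → ⟨ ΨPart a′ I , δ L′ ⟩ᴷ) ⟩ᴷ ≈ᴷ 0#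
    part-zero (suc k) L′ _ L′+ eq = R.trans (R.sym (pairing-linearExtension (ΨPart (suc k)) f))
      (Ψ-independent N (n ∸ k) (part k) (≤-trans (m∸n≤m n k) n≤N)
        (supported-linearExtension (ΨPart (suc k)) (ΨPart-supported (suc k) (suc n)) f-supported)
        (powerSums-free (suc n) (λ k → Ψ̂ (part k)) (λ w → R.trans (R.sym (Ψ̂-decomposition (δ w) n f f-supported)) (f≈0 w))
          k (≤-trans (m≤m+n (suc k) (sum L′)) (≤-reflexive eq)))
        L′ (L′+ , trans (sym (m+n∸m≡n k (sum L′))) (cong (_∸ k) (suc-injective eq))))

  -- Gaussian binomials count nondecreasing words

  gauss-zero : ∀ {n k} → n < k → gauss n k ≈ᴷ 0#
  gauss-zero {zero}  {suc k} _   = R.refl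
  gauss-zero {suc n} {suc k} n<k = R.trans
    (R.+-cong (gauss-zero (s≤s⁻¹ n<k)) (R.trans (R.*-congˡ (gauss-zero (m<n⇒m<1+n (s≤s⁻¹ n<k)))) (R.zeroʳ _)))
    (R.+-identityˡ 0#)

  -- The q-Pascal rule dual to the recursion that defines `gauss`, with the difference of the
  -- indices as the variable `y` to avoid subtraction. In `qSum-gauss` its last term accounts for
  -- the largest letter `suc y`.
  gauss-pascal : ∀ y m → gauss (suc (y + m)) (suc m) ≈ᴷ gauss (y + m) (suc m) +ᴷ q ^ y * gauss (y + m) m
  gauss-pascal zero m = begin
    gauss m m +ᴷ q ^ suc m * gauss m (suc m)   ≈⟨ R.+-congˡ (R.trans (R.*-congˡ (gauss-zero (n<1+n m))) (R.zeroʳ _)) ⟩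
    gauss m m +ᴷ 0#                            ≈⟨ R.+-comm _ _ ⟩
    0# +ᴷ gauss m m                            ≈⟨ R.+-cong (R.sym (gauss-zero (n<1+n m))) (R.sym (R.*-identityˡ _)) ⟩
    gauss m (suc m) +ᴷ 1# * gauss m m          ∎
  gauss-pascal (suc y) zero = begin
    1# +ᴷ (q * 1#) * gauss (suc (y + 0)) 1     ≈⟨ R.+-congˡ (R.*-congˡ (gauss-pascal y 0)) ⟩
    1# +ᴷ (q * 1#) * (gauss (y + 0) 1 +ᴷ q ^ y * 1#)
      ≈⟨ solve 4 (λ o x g p → o :+ (x :* o) :* (g :+ p :* o) := (o :+ (x :* o) :* g) :+ (x :* o) :* (p :* o)) R.refl 1# q (gauss (y + 0) 1) (q ^ y) ⟩
    (1# +ᴷ (q * 1#) * gauss (y + 0) 1) +ᴷ (q * 1#) * (q ^ y * 1#)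
      ≈⟨ R.+-congˡ (R.trans (R.*-congʳ (R.*-identityʳ q)) (R.sym (R.*-assoc _ _ _))) ⟩
    (1# +ᴷ (q * 1#) * gauss (y + 0) 1) +ᴷ (q * q ^ y) * 1# ∎
  gauss-pascal (suc y) (suc m) = begin
    gauss (suc n) (suc m) +ᴷ q ^ (2 + m) * gauss (suc n) (2 + m)
      ≈⟨ R.+-cong first (R.*-congˡ (gauss-pascal y (suc m))) ⟩
    (gauss n (suc m) +ᴷ (q * q ^ y) * gauss n m) +ᴷ (q * q ^ suc m) * (gauss n (2 + m) +ᴷ q ^ y * gauss n (suc m))
      ≈⟨ solve 6 (λ x p r a b d → (b :+ (x :* p) :* a) :+ (x :* r) :* (d :+ p :* b) := (b :+ (x :* r) :* d) :+ (x :* p) :* (a :+ r :* b)) R.refl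
           q (q ^ y) (q ^ suc m) (gauss n m) (gauss n (suc m)) (gauss n (2 + m)) ⟩
    (gauss n (suc m) +ᴷ (q * q ^ suc m) * gauss n (2 + m)) +ᴷ (q * q ^ y) * (gauss n m +ᴷ q ^ suc m * gauss n (suc m)) ∎
    where
    n = y + suc m
    first : gauss (suc n) (suc m) ≈ᴷ gauss n (suc m) +ᴷ (q * q ^ y) * gauss n m
    first = subst (λ k → gauss (suc k) (suc m) ≈ᴷ gauss k (suc m) +ᴷ (q * q ^ y) * gauss k m) (sym (+-suc y m)) (gauss-pascal (suc y) m)

  -- A sum over the letters `suc x` up to `y`, each weighted by the `x` special inversions that it
  -- adds.
  qSum : (ℕ → Carrier) → ℕ → Carrier
  qSum g y = ∑ᴷ (upTo y) (λ x → q ^ x * g (suc x))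

  -- The innermost sum belongs to the leftmost letter of the block, the first that `prefixed-sum`
  -- sums away; its bound is the letter to its right.
  qSums : ℕ → (ℕ → Carrier) → ℕ → Carrier
  qSums zero    g = g
  qSums (suc j) g = qSums j (qSum g)

  qSums-cong : ∀ j {g g′} → (∀ y → g y ≈ᴷ g′ y) → ∀ y → qSums j g y ≈ᴷ qSums j g′ y
  qSums-cong zero    eq = eq
  qSums-cong (suc j) eq = qSums-cong j (λ y → ∑ᴷ-cong (upTo y) (λ _ → R.*-congˡ (eq _)))

  qSum-gauss : ∀ m y → qSum (λ y → gauss (y + m ∸ 1) m) y ≈ᴷ gauss (y + suc m ∸ 1) (suc m)
  -- No letter is available, and the upper index is `m`, below the lower index `suc m`.
  qSum-gauss m zero    = R.sym (gauss-zero (n<1+n m))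
  qSum-gauss m (suc y) = begin
    qSum (λ y → gauss (y + m ∸ 1) m) (suc y)                   ≈⟨ ∑ᴷ-upTo-suc y ⟩
    qSum (λ y → gauss (y + m ∸ 1) m) y +ᴷ q ^ y * gauss (y + m) m ≈⟨ R.+-congʳ (qSum-gauss m y) ⟩
    gauss (y + suc m ∸ 1) (suc m) +ᴷ q ^ y * gauss (y + m) m   ≈⟨ R.+-congʳ (R.reflexive (cong (λ n → gauss (n ∸ 1) (suc m)) (+-suc y m))) ⟩
    gauss (y + m) (suc m) +ᴷ q ^ y * gauss (y + m) m           ≈⟨ gauss-pascal y m ⟨
    gauss (suc (y + m)) (suc m)                                ≈⟨ R.reflexive (cong (λ n → gauss n (suc m)) (sym (+-suc y m))) ⟩
    gauss (y + suc m) (suc m)                                  ∎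

  -- Only `m = 0` is needed in the end; a general `m` records the sums already carried out.
  qSums-gauss : ∀ j m y → qSums j (λ y → gauss (y + m ∸ 1) m) y ≈ᴷ gauss (y + (j + m) ∸ 1) (j + m)
  qSums-gauss zero    m y = R.refl
  qSums-gauss (suc j) m y = begin
    qSums j (qSum (λ y → gauss (y + m ∸ 1) m)) y           ≈⟨ qSums-cong j (qSum-gauss m) y ⟩
    qSums j (λ y → gauss (y + suc m ∸ 1) (suc m)) y        ≈⟨ qSums-gauss j (suc m) y ⟩
    gauss (y + (j + suc m) ∸ 1) (j + suc m)                ≈⟨ R.reflexive (cong (λ k → gauss (y + k ∸ 1) k) (+-suc j m)) ⟩
    gauss (y + suc (j + m) ∸ 1) (suc (j + m))              ∎

  qSums-one : ∀ j y → qSums j (λ _ → 1#) y ≈ᴷ gauss (y + j ∸ 1) j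
  qSums-one j y = R.trans (qSums-gauss j 0 y) (R.reflexive (cong (λ k → gauss (y + k ∸ 1) k) (+-identityʳ j)))

  -- The generating function of prefixed words

  ^-+ : ∀ m n → q ^ (m + n) ≈ᴷ q ^ m * q ^ n
  ^-+ zero    n = R.sym (R.*-identityˡ _)
  ^-+ (suc m) n = R.trans (R.*-congˡ (^-+ m n)) (R.sym (R.*-assoc _ _ _))

  -- The function `g` holds the contribution of the letters already summed away on the left, which
  -- depends on `w` only through its first letter.
  weight : List ℕ → (ℕ → Carrier) → Word → Carrier
  weight I g w = q ^ specialInversions w * (δ I (wc w) * g (firstLetter w))

  module _ {w k} (r : Range w k) (I : List ℕ) (g : ℕ → Carrier) where

    weigh : ∀ b (f : ℕ → Word) L → (∀ {x} → x < b → firstLetter (f (suc x)) ≡ suc x) →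
      (∀ {x} → x < b → specialInversions (f (suc x)) ≡ x + specialInversions w) → (∀ {x} → x < b → wc (f (suc x)) ≡ L) →
      ∑ᴷ (map f (letters≤ b)) (weight I g) ≈ᴷ q ^ specialInversions w * (δ I L * qSum g b)
    weigh b f L first≡ inv≡ wc≡ = begin
      ∑ᴷ (map f (letters≤ b)) (weight I g)
        ≈⟨ R.reflexive (trans (∑ᴷ-map f (letters≤ b)) (∑ᴷ-map suc (upTo b))) ⟩
      ∑ᴷ (upTo b) (λ x → weight I g (f (suc x)))
        ≈⟨ ∑ᴷ-cong (upTo b) (λ {x} x∈ → term x (∈-upTo⁻ x∈)) ⟩
      ∑ᴷ (upTo b) (λ x → (q ^ specialInversions w * δ I L) * (q ^ x * g (suc x)))
        ≈⟨ ∑ᴷ-*ˡ (upTo b) _ ⟩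
      (q ^ specialInversions w * δ I L) * qSum g b
        ≈⟨ R.*-assoc _ _ _ ⟩
      q ^ specialInversions w * (δ I L * qSum g b) ∎
      where
      term : ∀ x → x < b → weight I g (f (suc x)) ≈ᴷ (q ^ specialInversions w * δ I L) * (q ^ x * g (suc x))
      term x x<b rewrite first≡ x<b | inv≡ x<b | wc≡ x<b = R.trans (R.*-congʳ (^-+ x (specialInversions w)))
        (solve 4 (λ a b d e → (a :* b) :* (d :* e) := (b :* d) :* (a :* e)) R.refl (q ^ x) (q ^ specialInversions w) (δ I L) (g (suc x)))

    extensions-sum : ∀ {a b} → a ≤ k → b ≤ suc k → ∑ᴷ (extensions a b w) (weight I g) ≈ᴷ
      q ^ specialInversions w * (δ I (increment (wc w)) * qSum g a) +ᴷ q ^ specialInversions w * (δ I (1 ∷ wc w) * qSum g b)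
    extensions-sum {a} {b} a≤k b≤sk = R.trans (∑ᴷ-++ (map (_∷ w) (letters≤ a))) (R.+-cong
      (weigh a (_∷ w) (increment (wc w)) (λ _ → refl)
        (λ x<a → specialInversions-∷ r (<⇒≤ (≤-trans x<a a≤k)))
        (λ {x} x<a → wc-∈ (from (r (suc x)) (z<s , ≤-trans x<a a≤k))))
      (weigh b (prepend w) (1 ∷ wc w) (λ _ → refl)
        (λ x<b → specialInversions-shift r (s≤s⁻¹ (≤-trans x<b b≤sk)))
        (λ {x} _ → wc-shift (suc x) w)))
      where open Equivalence using (from)

    -- A first part 1 forces a new letter, since `increment` makes a positive first part at least 2.
    extensions-sum-new : ∀ {I′ a b} → I ≡ 1 ∷ I′ → a ≤ k → b ≤ suc k →
      ∑ᴷ (extensions a b w) (weight I g) ≈ᴷ q ^ specialInversions w * (δ (removeCell I) (wc w) * qSum g b)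
    extensions-sum-new {I′} {a} {b} refl a≤k b≤sk = begin
      ∑ᴷ (extensions a b w) (weight I g)
        ≈⟨ extensions-sum a≤k b≤sk ⟩
      Q * (δ I (increment (wc w)) * qSum g a) +ᴷ Q * (δ I (1 ∷ wc w) * qSum g b)
        ≈⟨ R.+-cong (R.trans (R.*-congˡ (R.trans (R.*-congʳ (R.reflexive (𝟙-no (increment (wc w) ≟ᴸ I) (increment≢ (wc-positive w))))) (R.zeroˡ _))) (R.zeroʳ _))
             (R.*-congˡ (R.*-congʳ (R.reflexive (𝟙-cong (1 ∷ wc w ≟ᴸ I) (wc w ≟ᴸ I′) ∷-injectiveʳ (cong (1 ∷_)))))) ⟩
      0# +ᴷ Q * (δ I′ (wc w) * qSum g b)
        ≈⟨ R.+-identityˡ _ ⟩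
      Q * (δ I′ (wc w) * qSum g b) ∎
      where
      Q = q ^ specialInversions w
      increment≢ : ∀ {L} → All (0 <_) L → increment L ≢ 1 ∷ I′
      increment≢ {[]}        _        ()
      increment≢ {zero ∷ L}  (() ∷ _) _
      increment≢ {suc l ∷ L} _        ()

    -- A first part of at least 2 forces an old letter, since a new one opens a part 1.
    extensions-sum-old : ∀ {i I′ a b} → I ≡ suc (suc i) ∷ I′ → a ≤ k → b ≤ suc k →
      ∑ᴷ (extensions a b w) (weight I g) ≈ᴷ q ^ specialInversions w * (δ (removeCell I) (wc w) * qSum g a)
    extensions-sum-old {i} {I′} {a} {b} refl a≤k b≤sk = begin
      ∑ᴷ (extensions a b w) (weight I g)
        ≈⟨ extensions-sum a≤k b≤sk ⟩
      Q * (δ I (increment (wc w)) * qSum g a) +ᴷ Q * (δ I (1 ∷ wc w) * qSum g b)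
        ≈⟨ R.+-cong (R.*-congˡ (R.*-congʳ (R.reflexive (𝟙-cong (increment (wc w) ≟ᴸ I) (wc w ≟ᴸ suc i ∷ I′) (decrement (wc w)) (cong increment)))))
             (R.trans (R.*-congˡ (R.trans (R.*-congʳ (R.reflexive (𝟙-no (1 ∷ wc w ≟ᴸ I) (λ ())))) (R.zeroˡ _))) (R.zeroʳ _)) ⟩
      Q * (δ (suc i ∷ I′) (wc w) * qSum g a) +ᴷ 0#
        ≈⟨ R.+-identityʳ _ ⟩
      Q * (δ (suc i ∷ I′) (wc w) * qSum g a) ∎
      where
      Q = q ^ specialInversions w
      decrement : ∀ L → increment L ≡ I → L ≡ suc i ∷ I′
      decrement []      ()
      decrement (l ∷ L) refl = refl

  -- Summing away the leftmost letter removes one cell of `I` and turns `g` into `qSum g`. After `j`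
  -- such steps only the rightmost letter of the block is left, and its number of choices is the
  -- number of parts that remain at that moment.
  prefixed-sum : ∀ j {v} → Packed v → ∀ I g → All (0 <_) I → j < sum I →
    ∑ᴷ (prefixed (suc j) v) (weight I g) ≈ᴷ
    q ^ specialInversions v * (δ (removeCells (suc j) I) (wc v) * qSums (suc j) g (length (removeCells j I)))
  prefixed-sum zero {v} v-packed I g I+ 0<sum
    rewrite removeCells-suc 0 I+ | removeCells-zero (removeCell-positive I+) | removeCells-zero I+ = first-letter I I+ 0<sum
    where
    r = packed⇒range-lasts v-packed

    -- The bound on the letter comes from `v`; wherever `δ` is nonzero, the number of parts of `L`
    -- determines it.
    replace : ∀ L {m n} → (wc v ≡ L → m ≡ n) → δ L (wc v) * qSum g m ≈ᴷ δ L (wc v) * qSum g n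
    replace L m≡n with wc v ≟ᴸ L
    ... | yes eq = R.*-congˡ (R.reflexive (cong (qSum g) (m≡n eq)))
    ... | no  _  = R.trans (R.zeroˡ _) (R.sym (R.zeroˡ _))

    first-letter : ∀ I → All (0 <_) I → 0 < sum I → ∑ᴷ (prefixed 1 v) (weight I g) ≈ᴷ
      q ^ specialInversions v * (δ (removeCell I) (wc v) * qSum g (length I))
    first-letter (zero ∷ I)        (() ∷ _) _
    first-letter (suc zero ∷ I)    _        _ = R.trans (extensions-sum-new r (1 ∷ I) g refl ≤-refl ≤-refl)
      (R.*-congˡ (replace I (λ eq → cong suc (trans (sym (length-wc v)) (cong length eq)))))
    first-letter (suc (suc i) ∷ I) _        _ = R.trans (extensions-sum-old r (suc (suc i) ∷ I) g refl ≤-refl ≤-refl)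
      (R.*-congˡ (replace (suc i ∷ I) (λ eq → trans (sym (length-wc v)) (cong length eq))))
  prefixed-sum (suc j) {v} v-packed I g I+ j<sum
    rewrite removeCells-suc (suc j) I+ | removeCells-suc j I+ = begin
    ∑ᴷ (concatMap grow (prefixed (suc j) v)) (weight I g)
      ≈⟨ ∑ᴷ-concatMap grow (prefixed (suc j) v) ⟩
    ∑ᴷ (prefixed (suc j) v) (λ w → ∑ᴷ (grow w) (weight I g))
      ≈⟨ ∑ᴷ-cong (prefixed (suc j) v) (λ {w} w∈ → grow-sum I I+ (≤-trans z<s j<sum) (packed⇒range-lasts (Prefixed.isPacked (∈-prefixed⁻ v-packed (suc j) w∈)))) ⟩
    ∑ᴷ (prefixed (suc j) v) (weight (removeCell I) (qSum g))
      ≈⟨ prefixed-sum j v-packed (removeCell I) (qSum g) (removeCell-positive I+) (smaller I I+ j<sum) ⟩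
    q ^ specialInversions v * (δ (removeCells (suc j) (removeCell I)) (wc v) * qSums (suc j) (qSum g) (length (removeCells j (removeCell I)))) ∎
    where
    grow-sum : ∀ I → All (0 <_) I → 0 < sum I → ∀ {w} → Range w (length (lasts w)) →
      ∑ᴷ (grow w) (weight I g) ≈ᴷ weight (removeCell I) (qSum g) w
    grow-sum (zero ∷ I)        (() ∷ _) _
    grow-sum (suc zero ∷ I)    _ _ r = extensions-sum-new r (1 ∷ I) g refl (firstLetter≤ r) (m≤n⇒m≤1+n (firstLetter≤ r))
    grow-sum (suc (suc i) ∷ I) _ _ r = extensions-sum-old r (suc (suc i) ∷ I) g refl (firstLetter≤ r) (m≤n⇒m≤1+n (firstLetter≤ r))

    smaller : ∀ I → All (0 <_) I → suc j < sum I → j < sum (removeCell I)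
    smaller I I+ lt with sum I in eq
    ... | suc n = subst (j <_) (sym (sum-removeCell (I+ , eq))) (s≤s⁻¹ lt)

  -- The product ⋆

  nondecreasing⇒no-inversions : ∀ {w} → Linked _≤_ w → specialInversions w ≡ 0
  nondecreasing⇒no-inversions l = go (Linked.Linked⇒AllPairs ≤-trans l)
    where
    go : ∀ {w} → AllPairs _≤_ w → specialInversions w ≡ 0
    go []                  = refl
    go {x ∷ w} (x≤w ∷ w↑) = cong₂ _+_ (cong length (filter-none (_<? x) (All.tabulate (λ y∈ → ≤⇒≯ (All.lookup x≤w (∈-lasts⁻ y∈)))))) (go w↑)

  ^-inverse : ∀ n x → q⁻¹ ^ n * (q ^ n * x) ≈ᴷ x
  ^-inverse zero    x = R.trans (R.*-identityˡ _) (R.*-identityˡ _)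
  ^-inverse (suc n) x = begin
    (q⁻¹ * q⁻¹ ^ n) * ((q * q ^ n) * x)
      ≈⟨ solve 5 (λ a b d e x → (a :* b) :* ((d :* e) :* x) := (d :* a) :* (b :* (e :* x))) R.refl q⁻¹ (q⁻¹ ^ n) q (q ^ n) x ⟩
    (q * q⁻¹) * (q⁻¹ ^ n * (q ^ n * x))
      ≈⟨ R.*-cong R.q*q⁻¹≈1 (^-inverse n x) ⟩
    1# * x
      ≈⟨ R.*-identityˡ x ⟩
    x ∎

  pairing-scaled : ∀ {X : Set} (s : X → Carrier) f {φ} → ⟨ linearExtension (λ u → s u • basis u) f , φ ⟩ᴷ ≈ᴷ ⟨ f , (λ u → s u * φ u) ⟩ᴷ
  pairing-scaled s f {φ} = R.trans (pairing-linearExtension (λ u → s u • basis u) f)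
    (pairing-cong f (λ {_} {u} _ → R.trans (pairing-• (s u) (basis u) {φ}) (R.*-congˡ (pairing-basis u {φ}))))

  q^sinv q⁻¹^sinv : PackedWord → Carrier
  q^sinv u = q ^ sinv (letters u)
  q⁻¹^sinv u = q⁻¹ ^ sinv (letters u)

  -- Multiplication by `αS j` is moved over to the functional. The unscaling of `αS j` is trivial,
  -- since nondecreasing words have no special inversions; that of `v` stays and cancels the
  -- inversions inside `v` in `product-sum`.
  pairing-⋆ : ∀ j f φ → ⟨ αS j ⋆ f , φ ⟩ᴷ ≈ᴷ ⟨ f , (λ v → q⁻¹^sinv v * ∑ᴷ (product j v) (λ w → q^sinv w * φ w)) ⟩ᴷ
  pairing-⋆ j f φ = begin
    ⟨ αS j ⋆ f , φ ⟩ᴷ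
      ≈⟨ pairing-scaled q^sinv (unscale (αS j) ⊙ unscale f) ⟩
    ⟨ unscale (αS j) ⊙ unscale f , φ′ ⟩ᴷ
      ≈⟨ pairing-bilinearExtension (λ u v → ∑ (convolution u v) M) (unscale (αS j)) (unscale f) ⟩
    ⟨ unscale (αS j) , (λ u → ⟨ unscale f , (λ v → ⟨ ∑ (convolution u v) M , φ′ ⟩ᴷ) ⟩ᴷ) ⟩ᴷ
      ≈⟨ pairing-scaled q⁻¹^sinv (αS j) ⟩
    ⟨ αS j , (λ u → q⁻¹^sinv u * ⟨ unscale f , (λ v → ⟨ ∑ (convolution u v) M , φ′ ⟩ᴷ) ⟩ᴷ) ⟩ᴷ
      ≈⟨ pairing-∑-basis (nondecreasingPackedWords j) ⟩
    ∑ᴷ (nondecreasingPackedWords j) (λ u → q⁻¹^sinv u * ⟨ unscale f , (λ v → ⟨ ∑ (convolution u v) M , φ′ ⟩ᴷ) ⟩ᴷ)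
      ≈⟨ ∑ᴷ-cong (nondecreasingPackedWords j) (λ {u} u∈ → R.trans
           (R.*-cong (R.reflexive (cong (q⁻¹ ^_) (trans (sinv≡specialInversions (letters u)) (nondecreasing⇒no-inversions (proj₂ (∈-nondecreasing⁻ {j} u∈))))))
             (R.trans (pairing-scaled q⁻¹^sinv f) (pairing-cong f (λ {_} {v} _ → R.*-congˡ (pairing-∑-basis (convolution u v))))))
           (R.*-identityˡ _)) ⟩
    ∑ᴷ (nondecreasingPackedWords j) (λ u → ⟨ f , (λ v → q⁻¹^sinv v * ∑ᴷ (convolution u v) φ′) ⟩ᴷ)
      ≈⟨ pairing-∑ᴷ f (nondecreasingPackedWords j) ⟨
    ⟨ f , (λ v → ∑ᴷ (nondecreasingPackedWords j) (λ u → q⁻¹^sinv v * ∑ᴷ (convolution u v) φ′)) ⟩ᴷ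
      ≈⟨ pairing-cong f (λ {_} {v} _ → R.trans (∑ᴷ-*ˡ (nondecreasingPackedWords j) (q⁻¹^sinv v))
           (R.*-congˡ (R.sym (∑ᴷ-concatMap (λ u → convolution u v) (nondecreasingPackedWords j))))) ⟩
    ⟨ f , (λ v → q⁻¹^sinv v * ∑ᴷ (product j v) φ′) ⟩ᴷ ∎
    where
    φ′ : PackedWord → Carrier
    φ′ w = q^sinv w * φ w

  -- Formally the coefficient of Ψ_I after `ζ`; that it really is this coefficient rests on linear
  -- independence.
  atWC : List ℕ → PackedWord → Carrier
  atWC I u = δ I (WC (letters u))

  product-sum : ∀ j v I → All (0 <_) I → j < sum I →
    q⁻¹^sinv v * ∑ᴷ (product (suc j) v) (λ w → q^sinv w * atWC I w) ≈ᴷ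
    gauss (length (removeCells j I) + suc j ∸ 1) (suc j) * atWC (removeCells (suc j) I) v
  product-sum j v I I+ j<sum = begin
    q⁻¹^sinv v * ∑ᴷ (product (suc j) v) (λ w → q^sinv w * atWC I w)
      ≈⟨ R.*-congˡ (∑ᴷ-cong (product (suc j) v) (λ {w} _ → R.*-cong
           (R.reflexive (cong (q ^_) (sinv≡specialInversions (letters w))))
           (R.trans (R.reflexive (cong (δ I) (WC≡wc (letters w)))) (R.sym (R.*-identityʳ _))))) ⟩
    q⁻¹^sinv v * ∑ᴷ (product (suc j) v) (λ w → weight I (λ _ → 1#) (letters w))
      ≈⟨ R.*-congˡ (R.reflexive (sym (∑ᴷ-map letters (product (suc j) v)))) ⟩
    q⁻¹^sinv v * ∑ᴷ (map letters (product (suc j) v)) (weight I (λ _ → 1#))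
      ≈⟨ R.*-congˡ (∑ᴷ-↭ (product-↭-prefixed (suc j) v)) ⟩
    q⁻¹^sinv v * ∑ᴷ (prefixed (suc j) (letters v)) (weight I (λ _ → 1#))
      ≈⟨ R.*-cong (R.reflexive (cong (q⁻¹ ^_) (sinv≡specialInversions (letters v)))) (prefixed-sum j (letters-packed v) I (λ _ → 1#) I+ j<sum) ⟩
    q⁻¹ ^ s * (q ^ s * (δ I′ (wc (letters v)) * qSums (suc j) (λ _ → 1#) k))
      ≈⟨ ^-inverse s _ ⟩
    δ I′ (wc (letters v)) * qSums (suc j) (λ _ → 1#) k
      ≈⟨ R.*-comm _ _ ⟩
    qSums (suc j) (λ _ → 1#) k * δ I′ (wc (letters v))
      ≈⟨ R.*-cong (qSums-one (suc j) k) (R.reflexive (cong (δ I′) (sym (WC≡wc (letters v))))) ⟩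
    gauss (k + suc j ∸ 1) (suc j) * atWC I′ v ∎
    where
    s  = specialInversions (letters v)
    I′ = removeCells (suc j) I
    k  = length (removeCells j I)

  -- The recursion for the formal coefficients of S^J(q)

  F^ : List ℕ → WQSym
  F^ = foldr (λ j f → αS j ⋆ f) (M ε)

  F^-coefficient : ∀ j J I → All (0 <_) I → j < sum I →
    ⟨ F^ (suc j ∷ J) , atWC I ⟩ᴷ ≈ᴷ gauss (length (removeCells j I) + suc j ∸ 1) (suc j) * ⟨ F^ J , atWC (removeCells (suc j) I) ⟩ᴷ
  F^-coefficient j J I I+ j<sum = R.trans (pairing-⋆ (suc j) (F^ J) (atWC I))
    (R.trans (pairing-cong (F^ J) (λ {_} {v} _ → product-sum j v I I+ j<sum)) (pairing-*ˡ (F^ J) _))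

  -- Homogeneity, and identification with the true coefficients

  HasLength : ℕ → PackedWord → Set
  HasLength n u = length (letters u) ≡ n

  basis-supported : ∀ {X : Set} {P : X → Set} {x} r → P x → Supported P (r • basis x)
  basis-supported r p = p ∷ []

  ∑-basis-supported : ∀ {X : Set} {P : X → Set} (xs : List X) → (∀ {x} → x ∈ xs → P x) → Supported P (∑ xs basis)
  ∑-basis-supported []       h = []
  ∑-basis-supported (x ∷ xs) h = h (here refl) ∷ ∑-basis-supported xs (h ∘ there)

  ⋆-supported : ∀ j {m} f → Supported (HasLength m) f → Supported (HasLength (j + m)) (αS j ⋆ f)
  ⋆-supported j {m} f f-supported = supported-linearExtension {P = HasLength (j + m)} M′ (λ u → basis-supported {P = HasLength (j + m)} {u} _)
    (supported-linearExtension {P = HasLength j} (λ u → linearExtension (λ v → ∑ (convolution u v) M) (unscale f))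
      (λ u len-u → supported-linearExtension {P = HasLength m} (λ v → ∑ (convolution u v) M)
        (λ v len-v → ∑-basis-supported (convolution u v) (λ {w} w∈ → trans (proj₁ (∈-convolution⁻ u v {w} w∈)) (cong₂ _+_ len-u len-v)))
        (unscale-supported f-supported))
      (unscale-supported (∑-basis-supported (nondecreasingPackedWords j) (λ {u} u∈ → proj₁ (∈-nondecreasing⁻ {j} {u} u∈)))))
    where
    unscale-supported : ∀ {n f} → Supported (HasLength n) f → Supported (HasLength n) (unscale f)
    unscale-supported {n} = supported-linearExtension {P = HasLength n} _ (λ u → basis-supported {P = HasLength n} {u} _)

  F^-supported : ∀ J → Supported (HasLength (sum J)) (F^ J)
  F^-supported []      = refl ∷ []
  F^-supported (j ∷ J) = ⋆-supported j (F^ J) (F^-supported J)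

  WC-⊨ : ∀ {n} u → HasLength n u → WC (letters u) ⊨ n
  WC-⊨ u len rewrite WC≡wc (letters u) = wc-positive (letters u) , trans (sum-wc (letters u)) len

  -- Two formal combinations of compositions, one from the W-compositions in `F^ J` and one with
  -- coefficients from `C`, have the same image S^J(q) under `Ψ̂`. Both are homogeneous of degree
  -- `n`, so `Ψ-independent` applies to their difference.
  coefficient-of-Ψ : ∀ C → IsCoefficientOfΨ C → ∀ n I J → I ⊨ n → J ⊨ n → C I J ≈ᴷ ⟨ F^ J , atWC I ⟩ᴷ
  coefficient-of-Ψ C isC n I J I⊨n J⊨n@(_ , sumJ≡n) = R.sym (begin
    ⟨ F^ J , atWC I ⟩ᴷ
      ≈⟨ pushforward (δ I) ⟨
    ⟨ f , δ I ⟩ᴷ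
      ≈⟨ R.+-identityʳ _ ⟨
    ⟨ f , δ I ⟩ᴷ +ᴷ 0#
      ≈⟨ R.+-congˡ (minus-cancel ⟨ g , δ I ⟩ᴷ) ⟨
    ⟨ f , δ I ⟩ᴷ +ᴷ ((-ᴷ 1#) * ⟨ g , δ I ⟩ᴷ +ᴷ ⟨ g , δ I ⟩ᴷ)
      ≈⟨ R.+-assoc _ _ _ ⟨
    (⟨ f , δ I ⟩ᴷ +ᴷ (-ᴷ 1#) * ⟨ g , δ I ⟩ᴷ) +ᴷ ⟨ g , δ I ⟩ᴷ
      ≈⟨ R.+-congʳ (R.trans (R.sym (pairing-⊖ f {g} {δ I})) (Ψ-independent n n (f ⊖ g) ≤-refl supported vanishes I I⊨n)) ⟩
    0# +ᴷ ⟨ g , δ I ⟩ᴷ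
      ≈⟨ R.+-identityˡ _ ⟩
    ⟨ g , δ I ⟩ᴷ
      ≈⟨ expansion (δ I) ⟩
    ∑ᴷ (compositions n) (λ L → C L J * δ I L)
      ≈⟨ ∑ᴷ-single (compositions-unique n) (∈-compositions⁺ n I⊨n) (λ {L} _ L≢I → R.trans (R.*-congˡ (R.reflexive (𝟙-no (L ≟ᴸ I) L≢I))) (R.zeroʳ _)) ⟩
    C I J * δ I I
      ≈⟨ R.trans (R.*-congˡ (R.reflexive (𝟙-yes (I ≟ᴸ I) refl))) (R.*-identityʳ _) ⟩
    C I J ∎)
    where
    f g : Lin (List ℕ)
    f = linearExtension (λ u → basis (WC (letters u))) (F^ J)
    g = ∑ (compositions n) (λ L → C L J • basis L)

    pushforward : ∀ ψ → ⟨ f , ψ ⟩ᴷ ≈ᴷ ⟨ F^ J , (λ u → ψ (WC (letters u))) ⟩ᴷ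
    pushforward ψ = R.trans (pairing-linearExtension (λ u → basis (WC (letters u))) (F^ J)) (pairing-cong (F^ J) (λ {_} {u} _ → pairing-basis (WC (letters u)) {ψ}))

    expansion : ∀ ψ → ⟨ g , ψ ⟩ᴷ ≈ᴷ ∑ᴷ (compositions n) (λ L → C L J * ψ L)
    expansion ψ = R.trans (pairing-∑ (compositions n) (λ L → C L J • basis L))
      (∑ᴷ-cong (compositions n) (λ {L} _ → R.trans (pairing-• (C L J) (basis L) {ψ}) (R.*-congˡ (pairing-basis L {ψ}))))

    supported : Supported (_⊨ n) (f ⊖ g)
    supported = All.++⁺
      (supported-linearExtension {P = HasLength n} _ (λ u len → WC-⊨ u len ∷ []) (subst (λ m → Supported (HasLength m) (F^ J)) sumJ≡n (F^-supported J)))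
      (supported-• _ g (g-supported (compositions n) (∈-compositions⁻ n)))
      where
      g-supported : ∀ Ls → (∀ {L} → L ∈ Ls → L ⊨ n) → Supported (_⊨ n) (∑ Ls (λ L → C L J • basis L))
      g-supported []       h = []
      g-supported (L ∷ Ls) h = h (here refl) ∷ g-supported Ls (h ∘ there)

    vanishes : IsZero (Ψ̂ (f ⊖ g))
    vanishes w = begin
      ⟨ Ψ̂ (f ⊖ g) , δ w ⟩ᴷ
        ≈⟨ pairing-linearExtension Ψ (f ⊖ g) ⟩
      ⟨ f ⊖ g , ψ ⟩ᴷ
        ≈⟨ pairing-⊖ f {g} {ψ} ⟩
      ⟨ f , ψ ⟩ᴷ +ᴷ (-ᴷ 1#) * ⟨ g , ψ ⟩ᴷ
        ≈⟨ R.+-congʳ (begin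
             ⟨ f , ψ ⟩ᴷ                                      ≈⟨ pushforward ψ ⟩
             ⟨ F^ J , (λ u → ψ (WC (letters u))) ⟩ᴷ          ≈⟨ pairing-linearExtension (λ u → Ψ (WC (letters u))) (F^ J) ⟨
             ⟨ S^ J ⟨q⟩ , δ w ⟩ᴷ                             ≈⟨ coefficient≈pairing (≡-dec _≟_) (S^ J ⟨q⟩) w ⟨
             coefficient (≡-dec _≟_) (S^ J ⟨q⟩) w            ≈⟨ isC n J J⊨n w ⟩
             coefficient (≡-dec _≟_) (∑ (compositions n) (λ L → C L J • Ψ L)) w ≈⟨ coefficient≈pairing (≡-dec _≟_) (∑ (compositions n) (λ L → C L J • Ψ L)) w ⟩
             ⟨ ∑ (compositions n) (λ L → C L J • Ψ L) , δ w ⟩ᴷ ≈⟨ pairing-∑ (compositions n) (λ L → C L J • Ψ L) ⟩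
             ∑ᴷ (compositions n) (λ L → ⟨ C L J • Ψ L , δ w ⟩ᴷ) ≈⟨ ∑ᴷ-cong (compositions n) (λ {L} _ → pairing-• (C L J) (Ψ L)) ⟩
             ∑ᴷ (compositions n) (λ L → C L J * ψ L)         ≈⟨ expansion ψ ⟨
             ⟨ g , ψ ⟩ᴷ                                      ∎) ⟩
      ⟨ g , ψ ⟩ᴷ +ᴷ (-ᴷ 1#) * ⟨ g , ψ ⟩ᴷ
        ≈⟨ R.trans (R.+-comm _ _) (minus-cancel ⟨ g , ψ ⟩ᴷ) ⟩
      0# ∎
      where
      ψ : List ℕ → Carrier
      ψ L = ⟨ Ψ L , δ w ⟩ᴷ

mainTheorem5 : ∀ {c ℓ} (K : GroundRing c ℓ) →
    let open NoncommutativeSymmetricFunctions K in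
    (C : List ℕ → List ℕ → Carrier) → IsCoefficientOfΨ C →
    ∀ (n i₁ : ℕ) (I : List ℕ) (j₁ : ℕ) (J : List ℕ) →
    (i₁ ∷ I) ⊨ n → (j₁ ∷ J) ⊨ n →
    let k = length (i₁ ∷ I) in
    (i₁ < j₁ → C (i₁ ∷ I) (j₁ ∷ J) ≈ᴷ C (mergeFirstTwo (i₁ ∷ I)) (j₁ ∷ J))
    ×
    (j₁ ≤ i₁ → C (i₁ ∷ I) (j₁ ∷ J) ≈ᴷ gauss (k + j₁ ∸ 1) j₁ * C (removeCells j₁ (i₁ ∷ I)) J)
mainTheorem5 K C isC n i₁ I zero    J _ (() ∷ _ , _)
mainTheorem5 K C isC n i₁ I (suc j) J I⊨n J⊨n@(_ ∷ J+ , sumJ≡n) = merge I I⊨n , remove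
  where
  open NoncommutativeSymmetricFunctions K
  module R = GroundRing K
  open SetoidReasoning R.setoid

  j<n : j < n
  j<n = ≤-trans (m≤m+n (suc j) (sum J)) (≤-reflexive sumJ≡n)

  C≈F^ : ∀ L → L ⊨ n → C L (suc j ∷ J) ≈ᴷ
    gauss (length (removeCells j L) + suc j ∸ 1) (suc j) * ⟨_,_⟩ᴷ K (F^ K J) (atWC K (removeCells (suc j) L))
  C≈F^ L L⊨n@(L+ , sumL≡n) = R.trans (coefficient-of-Ψ K C isC n L (suc j ∷ J) L⊨n J⊨n)
    (F^-coefficient K j J L L+ (subst (j <_) (sym sumL≡n) j<n))

  merge : ∀ I → (i₁ ∷ I) ⊨ n → i₁ < suc j → C (i₁ ∷ I) (suc j ∷ J) ≈ᴷ C (mergeFirstTwo (i₁ ∷ I)) (suc j ∷ J)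
  -- A single part equals `n`, which is at least `suc j`.
  merge []       (_ , sum≡n) i₁<j₁ = contradiction (≤-trans j<n (≤-reflexive (trans (sym sum≡n) (+-identityʳ i₁)))) (<⇒≱ i₁<j₁)
  merge (i₂ ∷ I) I⊨n@(p ∷ _ ∷ ps , sum≡n) i₁<j₁ = begin
    C (i₁ ∷ i₂ ∷ I) (suc j ∷ J)
      ≈⟨ C≈F^ (i₁ ∷ i₂ ∷ I) I⊨n ⟩
    value (removeCells j (i₁ ∷ i₂ ∷ I)) (removeCells (suc j) (i₁ ∷ i₂ ∷ I))
      -- The Gaussian factor looks at `I` after only `j` cells; `i₁ < suc j` still lets these
      -- consume the whole first row.
      ≡⟨ cong₂ value (removeCells-mergeFirstTwo j i₂ I (s≤s⁻¹ i₁<j₁)) (removeCells-mergeFirstTwo (suc j) i₂ I (<⇒≤ i₁<j₁)) ⟩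
    value (removeCells j (i₁ + i₂ ∷ I)) (removeCells (suc j) (i₁ + i₂ ∷ I))
      ≈⟨ C≈F^ (i₁ + i₂ ∷ I) (≤-trans p (m≤m+n i₁ i₂) ∷ ps , trans (+-assoc i₁ i₂ (sum I)) sum≡n) ⟨
    C (i₁ + i₂ ∷ I) (suc j ∷ J) ∎
    where
    value : List ℕ → List ℕ → Carrier
    value L L′ = gauss (length L + suc j ∸ 1) (suc j) * ⟨_,_⟩ᴷ K (F^ K J) (atWC K L′)

  remove : suc j ≤ i₁ → C (i₁ ∷ I) (suc j ∷ J) ≈ᴷ gauss (length (i₁ ∷ I) + suc j ∸ 1) (suc j) * C (removeCells (suc j) (i₁ ∷ I)) J
  remove j₁≤i₁ = R.trans (C≈F^ (i₁ ∷ I) I⊨n) (R.*-cong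
    (R.reflexive (cong (λ k → gauss (k + suc j ∸ 1) (suc j)) (length-removeCells I j₁≤i₁)))
    -- The remaining factor is turned back into a value of `C`, in degree `n ∸ suc j`.
    (R.sym (coefficient-of-Ψ K C isC (n ∸ suc j) (removeCells (suc j) (i₁ ∷ I)) J (removeCells-⊨ (suc j) I⊨n j<n)
      (J+ , trans (sym (m+n∸m≡n (suc j) (sum J))) (cong (_∸ suc j) sumJ≡n)))))
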